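{- Let $\Sigma$ be a signature and $\equiv$ an operad congruence of $T(\Sigma)$ which is compatible with the degree and of finite type. Then the linear map $\phi:\mathbf N(T(\Sigma)/_\equiv)\to\mathbf N(T(\Sigma))$ defined, for every reduced word $x$ on $T(\Sigma)/_\equiv$, by $$\phi(E_x)=\sum_{f\text{ reduced }\Sigma\text{ -forest}}[\pi_\equiv(f)=x]\;E_f$$ is a well-defined injective Hopf algebra morphism.
   Context: $\mathbb K$ is a field of characteristic zero; $[P]$ is $1$ if $P$ holds and $0$ otherwise. A signature is a set $\Sigma$ with an arity map $|\cdot|:\Sigma\to\mathbb N$; $\Sigma(n)$ is the set of elements of arity $n$. A $\Sigma$-term is either the leaf $\bot$ or $s(t_1,\dots,t_n)$ with $s\in\Sigma(n)$ and $\Sigma$-terms $t_i$; its degree is the number of internal nodes, its arity $|t|$ the number of leaves. $T(\Sigma)$ is the free nonsymmetric operad on $\Sigma$ (composition $t[t_1,\dots,t_{|t|}]$ grafts $t_i$ onto the $i$-th leaf of $t$, partial composition $\circ_i$ grafts onto the $i$-th leaf, unit $\bot$). A $\Sigma$-forest is a finite word of terms; it is reduced if no term is $\bot$. An operad congruence of $T(\Sigma)$ is an equivalence relation $\equiv$ such that $t\equiv t'$ implies $|t|=|t'|$, $t\circ_i s\equiv t'\circ_i s$ and $s\circ_j t\equiv s\circ_j t'$ for all $s$ and valid $i,j$. It is compatible with the degree if $t\equiv t'$ implies $\deg t=\deg t'$, and of finite type if all classes are finite. $\pi_\equiv:T(\Sigma)\to T(\Sigma)/_\equiv$ is the canonical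 projection, extended letterwise to words: $\pi_\equiv(t_1\cdots t_k)=\pi_\equiv(t_1)\cdots\pi_\equiv(t_k)$. Natural Hopf algebra: for a nonsymmetric operad $\mathcal O$ with unit $1$ which is finitely factorizable (each $x$ has finitely many factorizations $x=y[y'_1,\dots,y'_{|y|}]$) and has a grading $\deg$ ($\deg^{ -1}(0)=\{1\}$, additive under composition), $\mathbf N(\mathcal O)$ is the vector space with basis $E_w$ indexed by words $w$ on $\mathcal O\setminus\{1\}$ (reduced words), with product $E_{w_1}E_{w_2}=E_{w_1w_2}$ and coproduct the unique algebra morphism with $\Delta E_x=\sum_{y\in\mathcal O}\sum_{(y'_1,\dots,y'_{|y|})}[x=y[y'_1,\dots,y'_{|y|}]]\,E_{\mathrm{rd}(y)}\otimes E_{\mathrm{rd}(y'_1\cdots y'_{|y|})}$ for $x\in\mathcal O$, where $\mathrm{rd}$ deletes the letters equal to $1$ from a word; it is a graded Hopf algebra. Under the hypotheses, $T(\Sigma)/_\equiv$ is finitely factorizable and graded by the degree of representatives, so $\mathbf N(T(\Sigma)/_\equiv)$ is defined; $\mathbf N(T(\Sigma))$ has basis $E_f$ indexed by reduced $\Sigma$-forests. -}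

module Defs where

open import Algebra.Apartness.Bundles using (HeytingField; HeytingCommutativeRing)
open import Algebra.Bundles using (CommutativeRing)
open import Algebra.Module.Bundles using (Module)
import Algebra.Module.Construct.TensorUnit as TensorUnit
open import Algebra.Module.Morphism.Structures using (module ModuleMorphisms)
open import Algebra.Module.Structures.Biased using (IsModuleFromLeft)
import Algebra.Properties.Monoid.Mult as Mult
open import Data.Empty using (⊥-elim)
open import Data.Fin as Fin using (Fin; zero; suc; _↑ʳ_; toℕ)
import Data.Fin.Properties as Fin
open import Data.List as List using (List; []; _∷_)
open import Data.List.Membership.Propositional using (_∈_; find)
import Data.List.Membership.Propositional.Properties as ∈
import Data.List.Membership.Setoid as SetoidMembership
import Data.List.Relation.Binary.Equality.Setoid as ListEquality
open import Data.List.Relation.Unary.All as All using (All; []; _∷_)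
import Data.List.Relation.Unary.All.Properties as All
open import Data.List.Relation.Unary.AllPairs as AllPairs using (AllPairs; []; _∷_)
import Data.List.Relation.Unary.AllPairs.Properties as AllPairs
open import Data.List.Relation.Unary.Any as Any using (Any; here; there)
import Data.List.Relation.Unary.Unique.Propositional as UniqueP
import Data.List.Relation.Unary.Unique.Propositional.Properties as UniqueP
import Data.List.Relation.Unary.Unique.Setoid as UniqueSetoid
open import Data.Nat using (ℕ; zero; suc; _+_; _≟_)
import Data.Nat.Properties as ℕ
open import Data.Product using (Σ; Σ-syntax; ∃; ∃-syntax; _×_; _,_; proj₁; proj₂)
open import Data.Vec as Vec using (Vec; []; _∷_; _++_; take; drop; cast; replicate; sum; map; _[_]≔_)
import Data.Vec.Properties as Vec
open import Data.Vec.Relation.Binary.Pointwise.Inductive as VecPointwise using (Pointwise; []; _∷_)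
open import Function using (_∘_; id; flip)
open import Level using (Level; _⊔_) renaming (suc to lsuc)
open import Relation.Binary using (Rel; Setoid; IsEquivalence)
import Relation.Binary.Construct.On as On
open import Relation.Binary.PropositionalEquality as ≡ using (_≡_; refl; cong; cong₂; subst)
open import Relation.Nullary using (¬_; Dec; yes; no)
open import Relation.Nullary.Decidable using (map′)
open import Relation.Unary using (Pred)

private
  variable
    a b c ℓ ℓ₁ ℓ₂ m m′ n′ o p r x : Level
    A : Set a
    k l n : ℕ

-- The elements of S satisfying P, listed without repetition up to the
-- equality of S.  Sums over {a ∣ P a} are sums over `elements`.

record Enumeration (S : Setoid a ℓ) (P : Pred (Setoid.Carrier S) p) : Set (a ⊔ ℓ ⊔ p) where
  open Setoid S using (Carrier)
  open SetoidMembership S using () renaming (_∈_ to _∈ₛ_)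
  field
    elements : List Carrier
    sound    : All P elements
    complete : ∀ {y} → P y → y ∈ₛ elements
    unique   : UniqueSetoid.Unique S elements

dedupe : (S : Setoid a ℓ) (P : Pred (Setoid.Carrier S) p) →
         (∀ {y z} → P y → P z → Dec (Setoid._≈_ S y z)) →
         ∀ xs → All P xs → (∀ {y} → P y → SetoidMembership._∈_ S y xs) →
         Enumeration S P
dedupe S P dec xs allP compl = let ys , ps , u , inc = go xs allP in record
  { elements = ys ; sound = ps ; complete = inc ∘ compl ; unique = u }
  where
  open Setoid S hiding (refl)
  open SetoidMembership S using () renaming (_∈_ to _∈ₛ_)

  search : ∀ {y zs} → P y → All P zs → Dec (y ∈ₛ zs)
  search py []         = no λ ()
  search py (pz ∷ pzs) with dec py pz
  ... | yes y≈z = yes (here y≈z)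
  ... | no  y≉z = map′ there (λ { (here y≈z) → ⊥-elim (y≉z y≈z) ; (there q) → q }) (search py pzs)

  go : ∀ xs → All P xs →
       ∃[ ys ] All P ys × UniqueSetoid.Unique S ys × (∀ {y} → y ∈ₛ xs → y ∈ₛ ys)
  go []       []         = [] , [] , [] , id
  go (x ∷ xs) (px ∷ pxs) with go xs pxs
  ... | ys , ps , u , inc with search px ps
  ...   | yes x∈ys = ys , ps , u ,
                     λ { (here y≈x) → Any.map (trans y≈x) x∈ys ; (there q) → inc q }
  ...   | no  x∉ys = x ∷ ys , px ∷ ps , All.¬Any⇒All¬ ys x∉ys ∷ u ,
                     λ { (here y≈x) → here y≈x ; (there q) → there (inc q) }

unique⇒≟ : ∀ {xs : List A} → UniqueP.Unique xs → ∀ {y z} → y ∈ xs → z ∈ xs → Dec (y ≡ z)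
unique⇒≟ _          (here refl) (here refl) = yes refl
unique⇒≟ (x≢ ∷ _)   (here refl) (there q)   = no (All.lookup x≢ q)
unique⇒≟ (x≢ ∷ _)   (there p)   (here refl) = no (All.lookup x≢ p ∘ ≡.sym)
unique⇒≟ (_ ∷ u)    (there p)   (there q)   = unique⇒≟ u p q

composeAll : {A : Set a} (∣_∣ : A → ℕ) → ((x : A) → Vec A ∣ x ∣ → A) →
             (ys : Vec A n) → Vec A (sum (map ∣_∣ ys)) → Vec A n
composeAll ∣_∣ _⟦_⟧ []       zs = []
composeAll ∣_∣ _⟦_⟧ (y ∷ ys) zs =
  y ⟦ take ∣ y ∣ zs ⟧ ∷ composeAll ∣_∣ _⟦_⟧ ys (drop ∣ y ∣ zs)

-- `x ⟦ ys ⟧` is the full composition x[y₁,…,y_{|x|}].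

record Operad o ℓ : Set (lsuc (o ⊔ ℓ)) where
  field
    setoid : Setoid o ℓ
  open Setoid setoid public
  field
    ∣_∣       : Carrier → ℕ
    𝟏         : Carrier
    _⟦_⟧      : (x : Carrier) → Vec Carrier ∣ x ∣ → Carrier
    ∣∣-cong   : ∀ {x y} → x ≈ y → ∣ x ∣ ≡ ∣ y ∣
    ⟦⟧-cong   : ∀ {x x′ ys ys′} → x ≈ x′ → Pointwise _≈_ ys ys′ → x ⟦ ys ⟧ ≈ x′ ⟦ ys′ ⟧
    ∣𝟏∣       : ∣ 𝟏 ∣ ≡ 1
    ∣⟦⟧∣      : ∀ x ys → ∣ x ⟦ ys ⟧ ∣ ≡ sum (map ∣_∣ ys)
    identityˡ : ∀ x → 𝟏 ⟦ replicate ∣ 𝟏 ∣ x ⟧ ≈ x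
    identityʳ : ∀ x → x ⟦ replicate ∣ x ∣ 𝟏 ⟧ ≈ x
    assoc     : ∀ x ys zs →
                (x ⟦ ys ⟧) ⟦ cast (≡.sym (∣⟦⟧∣ x ys)) zs ⟧ ≈ x ⟦ composeAll ∣_∣ _⟦_⟧ ys zs ⟧

  Factorization : Set o
  Factorization = Σ[ y ∈ Carrier ] Vec Carrier ∣ y ∣

  factorizationSetoid : Setoid o (o ⊔ ℓ)
  factorizationSetoid = record
    { Carrier       = Factorization
    ; _≈_           = λ { (y , ys) (z , zs) → y ≈ z × Pointwise _≈_ ys zs }
    ; isEquivalence = record
      { refl  = Setoid.refl setoid , VecPointwise.refl (Setoid.refl setoid)
      ; sym   = λ { (e , es) → sym e , VecPointwise.sym sym es }
      ; trans = λ { (e , es) (f , fs) → trans e f , VecPointwise.trans trans es fs }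
      }
    }

  _factorizes_ : Factorization → Carrier → Set ℓ
  (y , ys) factorizes x = y ⟦ ys ⟧ ≈ x

FinitelyFactorizable : Operad o ℓ → Set (o ⊔ ℓ)
FinitelyFactorizable O = ∀ x → Enumeration factorizationSetoid (_factorizes x)
  where open Operad O

record Grading (O : Operad o ℓ) : Set (o ⊔ ℓ) where
  open Operad O
  field
    deg      : Carrier → ℕ
    deg-cong : ∀ {x y} → x ≈ y → deg x ≡ deg y
    deg-𝟏    : deg 𝟏 ≡ 0
    deg≡0⇒𝟏  : ∀ {x} → deg x ≡ 0 → x ≈ 𝟏
    deg-⟦⟧   : ∀ x ys → deg (x ⟦ ys ⟧) ≡ deg x + sum (map deg ys)

  _≟𝟏 : ∀ x → Dec (x ≈ 𝟏)
  x ≟𝟏 = map′ deg≡0⇒𝟏 (λ x≈𝟏 → ≡.trans (deg-cong x≈𝟏) deg-𝟏) (deg x ≟ 0)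

record Signature a : Set (lsuc a) where
  field
    Op : Set a
    ar : Op → ℕ

module Terms (Sig : Signature a) where
  open Signature Sig

  data Term : Set a where
    leaf : Term
    node : (s : Op) → Vec Term (ar s) → Term

  degree  : Term → ℕ
  degrees : Vec Term n → ℕ
  degree leaf        = 0
  degree (node s ts) = suc (degrees ts)
  degrees []         = 0
  degrees (t ∷ ts)   = degree t + degrees ts

  arity   : Term → ℕ
  arities : Vec Term n → ℕ
  arity leaf        = 1
  arity (node s ts) = arities ts
  arities []        = 0
  arities (t ∷ ts)  = arity t + arities ts

  graft  : (t : Term) → Vec Term (arity t) → Term
  grafts : (ts : Vec Term n) → Vec Term (arities ts) → Vec Term n
  graft leaf        (u ∷ []) = u
  graft (node s ts) us       = node s (grafts ts us)
  grafts []         us       = []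
  grafts (t ∷ ts)   us       = graft t (take (arity t) us) ∷ grafts ts (drop (arity t) us)

  _∘⟨_⟩_ : (t : Term) → Fin (arity t) → Term → Term
  t ∘⟨ i ⟩ s = graft t (replicate (arity t) leaf [ i ]≔ s)

  record Congruence r : Set (a ⊔ lsuc r) where
    infix 4 _≈_
    field
      _≈_           : Rel Term r
      isEquivalence : IsEquivalence _≈_
      arity-cong    : ∀ {t t′} → t ≈ t′ → arity t ≡ arity t′
      ∘-congˡ       : ∀ {t t′} (t≈t′ : t ≈ t′) i s →
                      t ∘⟨ i ⟩ s ≈ t′ ∘⟨ Fin.cast (arity-cong t≈t′) i ⟩ s
      ∘-congʳ       : ∀ {t t′} s j → t ≈ t′ → s ∘⟨ j ⟩ t ≈ s ∘⟨ j ⟩ t′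

    CompatibleWithDegree : Set (a ⊔ r)
    CompatibleWithDegree = ∀ {t t′} → t ≈ t′ → degree t ≡ degree t′

    FiniteType : Set (a ⊔ r)
    FiniteType = ∀ t → Enumeration (≡.setoid Term) (_≈ t)

  private
    split₁ : ∀ k l {n m} (xs : Vec A (k + m)) .(e : k + m ≡ (k + l) + n) →
             take k xs ≡ take k (take (k + l) (cast e xs))
    split₁ zero    l xs       e = refl
    split₁ (suc k) l (x ∷ xs) e = cong (x ∷_) (split₁ k l xs (ℕ.suc-injective e))

    split₂ : ∀ k l {n m} (xs : Vec A (k + m)) .(e′ : m ≡ l + n) .(e : k + m ≡ (k + l) + n) →
             take l (cast e′ (drop k xs)) ≡ drop k (take (k + l) (cast e xs))
    split₂ zero    l xs       e′ e = refl
    split₂ (suc k) l (x ∷ xs) e′ e = split₂ k l xs e′ (ℕ.suc-injective e)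

    split₃ : ∀ k l {n m} (xs : Vec A (k + m)) .(e′ : m ≡ l + n) .(e : k + m ≡ (k + l) + n) →
             drop l (cast e′ (drop k xs)) ≡ drop (k + l) (cast e xs)
    split₃ zero    l xs       e′ e = refl
    split₃ (suc k) l (x ∷ xs) e′ e = split₃ k l xs e′ (ℕ.suc-injective e)

    take-cast : ∀ {k l l′ n n′} (xs : Vec A k) .(e : k ≡ l + n) .(e′ : k ≡ l′ + n′)
                (p : l′ ≡ l) (q : n′ ≡ n) → take l (cast e xs) ≡ cast p (take l′ (cast e′ xs))
    take-cast xs e e′ refl refl = ≡.sym (Vec.cast-is-id refl _)

    drop-cast : ∀ {k l l′ n n′} (xs : Vec A k) .(e : k ≡ l + n) .(e′ : k ≡ l′ + n′)
                (p : l′ ≡ l) (q : n′ ≡ n) → drop l (cast e xs) ≡ cast q (drop l′ (cast e′ xs))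
    drop-cast xs e e′ refl refl = ≡.sym (Vec.cast-is-id refl _)

    take-all : (xs : Vec A (k + 0)) .(e : k + 0 ≡ k) → cast e xs ≡ take k xs
    take-all {k = zero}  []       e = refl
    take-all {k = suc k} (x ∷ xs) e = cong (x ∷_) (take-all xs (ℕ.suc-injective e))

    take-replicate : ∀ k l {y : A} → take k (replicate (k + l) y) ≡ replicate k y
    take-replicate zero    l = refl
    take-replicate (suc k) l = cong (_ ∷_) (take-replicate k l)

    drop-replicate : ∀ k l {y : A} → drop k (replicate (k + l) y) ≡ replicate l y
    drop-replicate zero    l = refl
    drop-replicate (suc k) l = drop-replicate k l

    take-↑ʳ : ∀ k {l} {y z : A} (i : Fin l) →
              take k (replicate (k + l) y [ k ↑ʳ i ]≔ z) ≡ replicate k y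
    take-↑ʳ zero    i = refl
    take-↑ʳ (suc k) i = cong (_ ∷_) (take-↑ʳ k i)

    drop-↑ʳ : ∀ k {l} {y z : A} (i : Fin l) →
              drop k (replicate (k + l) y [ k ↑ʳ i ]≔ z) ≡ replicate l y [ i ]≔ z
    drop-↑ʳ zero    i = refl
    drop-↑ʳ (suc k) i = drop-↑ʳ k i

    take-++ : (xs : Vec A k) (ys : Vec A l) → take k (xs ++ ys) ≡ xs
    take-++ []       ys = refl
    take-++ (x ∷ xs) ys = cong (x ∷_) (take-++ xs ys)

    drop-++ : (xs : Vec A k) (ys : Vec A l) → drop k (xs ++ ys) ≡ ys
    drop-++ []       ys = refl
    drop-++ (x ∷ xs) ys = drop-++ xs ys

  arities-split : ∀ k (us : Vec Term (k + l)) →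
                  arities us ≡ arities (take k us) + arities (drop k us)
  arities-split zero    us       = refl
  arities-split (suc k) (u ∷ us) =
    ≡.trans (cong (arity u +_) (arities-split k us)) (≡.sym (ℕ.+-assoc (arity u) _ _))

  degrees-split : ∀ k (us : Vec Term (k + l)) →
                  degrees us ≡ degrees (take k us) + degrees (drop k us)
  degrees-split zero    us       = refl
  degrees-split (suc k) (u ∷ us) =
    ≡.trans (cong (degree u +_) (degrees-split k us)) (≡.sym (ℕ.+-assoc (degree u) _ _))

  arity-graft   : ∀ t us → arity (graft t us) ≡ arities us
  arities-graft : ∀ (ts : Vec Term n) us → arities (grafts ts us) ≡ arities us
  arity-graft leaf        (u ∷ []) = ≡.sym (ℕ.+-identityʳ _)
  arity-graft (node s ts) us       = arities-graft ts us
  arities-graft []       []       = refl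
  arities-graft (t ∷ ts) us       =
    ≡.trans (cong₂ _+_ (arity-graft t _) (arities-graft ts _)) (≡.sym (arities-split (arity t) us))

  degree-graft   : ∀ t us → degree (graft t us) ≡ degree t + degrees us
  degrees-graft : ∀ (ts : Vec Term n) us → degrees (grafts ts us) ≡ degrees ts + degrees us
  degree-graft leaf        (u ∷ []) = ≡.sym (ℕ.+-identityʳ _)
  degree-graft (node s ts) us       = cong suc (degrees-graft ts us)
  degrees-graft []       []       = refl
  degrees-graft (t ∷ ts) us       = begin
    degree (graft t us₁) + degrees (grafts ts us₂)             ≡⟨ cong₂ _+_ (degree-graft t _) (degrees-graft ts _) ⟩
    (degree t + degrees us₁) + (degrees ts + degrees us₂)      ≡⟨ interchange (degree t) _ _ _ ⟩
    (degree t + degrees ts) + (degrees us₁ + degrees us₂)      ≡⟨ cong (degree t + degrees ts +_) (degrees-split (arity t) us) ⟨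
    (degree t + degrees ts) + degrees us                       ∎
    where
    open ≡.≡-Reasoning
    open import Algebra.Properties.CommutativeSemigroup ℕ.+-commutativeSemigroup using (interchange)
    us₁ = take (arity t) us
    us₂ = drop (arity t) us

  graft-identityʳ  : ∀ t → graft t (replicate (arity t) leaf) ≡ t
  grafts-identityʳ : ∀ (ts : Vec Term n) → grafts ts (replicate (arities ts) leaf) ≡ ts
  graft-identityʳ leaf        = refl
  graft-identityʳ (node s ts) = cong (node s) (grafts-identityʳ ts)
  grafts-identityʳ []       = refl
  grafts-identityʳ (t ∷ ts) = cong₂ _∷_
    (≡.trans (cong (graft t) (take-replicate (arity t) _)) (graft-identityʳ t))
    (≡.trans (cong (grafts ts) (drop-replicate (arity t) _)) (grafts-identityʳ ts))

  take-grafts : ∀ k (us : Vec Term (k + l)) vs →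
    take k (grafts us vs) ≡ grafts (take k us) (take _ (cast (arities-split k us) vs))
  take-grafts zero    us       vs = refl
  take-grafts (suc k) (u ∷ us) vs = cong₂ _∷_
    (cong (graft u) (split₁ (arity u) _ vs (arities-split (suc k) (u ∷ us))))
    (≡.trans (take-grafts k us _)
             (cong (grafts _) (split₂ (arity u) _ vs (arities-split k us) (arities-split (suc k) (u ∷ us)))))

  drop-grafts : ∀ k (us : Vec Term (k + l)) vs →
    drop k (grafts us vs) ≡
    grafts (drop k us) (drop (arities (take k us)) (cast (arities-split k us) vs))
  drop-grafts zero    us       vs = cong (grafts us) (≡.sym (Vec.cast-is-id refl vs))
  drop-grafts (suc k) (u ∷ us) vs =
    ≡.trans (drop-grafts k us _)
            (cong (grafts _) (split₃ (arity u) _ vs (arities-split k us) (arities-split (suc k) (u ∷ us))))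

  graft-assoc  : ∀ t us vs .(e : arities us ≡ arity (graft t us)) →
                 graft (graft t us) (cast e vs) ≡ graft t (grafts us vs)
  grafts-assoc : ∀ (ts : Vec Term n) us vs .(e : arities us ≡ arities (grafts ts us)) →
                 grafts (grafts ts us) (cast e vs) ≡ grafts ts (grafts us vs)
  graft-assoc leaf        (u ∷ []) vs e = cong (graft u) (take-all vs e)
  graft-assoc (node s ts) us       vs e = cong (node s) (grafts-assoc ts us vs e)
  grafts-assoc []       us vs e = refl
  grafts-assoc (t ∷ ts) us vs e = cong₂ _∷_
    (begin
      graft (graft t us₁) (take _ (cast e vs))       ≡⟨ cong (graft (graft t us₁)) (take-cast vs e e′ eᵃ eᵇ) ⟩
      graft (graft t us₁) (cast eᵃ (take _ (cast e′ vs))) ≡⟨ graft-assoc t us₁ _ eᵃ ⟩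
      graft t (grafts us₁ (take _ (cast e′ vs)))     ≡⟨ cong (graft t) (take-grafts (arity t) us vs) ⟨
      graft t (take (arity t) (grafts us vs))        ∎)
    (begin
      grafts (grafts ts us₂) (drop (arity (graft t us₁)) (cast e vs)) ≡⟨ cong (grafts (grafts ts us₂)) (drop-cast vs e e′ eᵃ eᵇ) ⟩
      grafts (grafts ts us₂) (cast eᵇ (drop (arities us₁) (cast e′ vs))) ≡⟨ grafts-assoc ts us₂ _ eᵇ ⟩
      grafts ts (grafts us₂ (drop (arities us₁) (cast e′ vs)))     ≡⟨ cong (grafts ts) (drop-grafts (arity t) us vs) ⟨
      grafts ts (drop (arity t) (grafts us vs))      ∎)
    where
    open ≡.≡-Reasoning
    us₁ = take (arity t) us
    us₂ = drop (arity t) us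
    e′  = arities-split (arity t) us
    eᵃ  = ≡.sym (arity-graft t us₁)
    eᵇ  = ≡.sym (arities-graft ts us₂)

  hole : (ws : Vec Term n) (i : Fin n) → Fin (arities (ws [ i ]≔ leaf))
  hole (w ∷ ws) zero    = zero
  hole (w ∷ ws) (suc i) = arity w ↑ʳ hole ws i

  grafts-hole : ∀ (ws : Vec Term n) i u →
                grafts (ws [ i ]≔ leaf) (replicate _ leaf [ hole ws i ]≔ u) ≡ ws [ i ]≔ u
  grafts-hole (w ∷ ws) zero    u = cong (u ∷_) (grafts-identityʳ ws)
  grafts-hole (w ∷ ws) (suc i) u = cong₂ _∷_
    (≡.trans (cong (graft w) (take-↑ʳ (arity w) (hole ws i))) (graft-identityʳ w))
    (≡.trans (cong (grafts (ws [ i ]≔ leaf)) (drop-↑ʳ (arity w) (hole ws i))) (grafts-hole ws i u))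

  private
    cast-replicate : ∀ {y z : A} (e : k ≡ l) i →
                     cast e (replicate k y [ i ]≔ z) ≡ replicate l y [ Fin.cast e i ]≔ z
    cast-replicate {k = k} {y = y} {z} refl i =
      ≡.trans (Vec.cast-is-id refl _) (cong (replicate k y [_]≔ z) (≡.sym (Fin.cast-is-id refl i)))

  plug : ∀ t (e : n ≡ arity t) (ws : Vec Term n) i →
         Σ[ j ∈ Fin (arity (graft t (cast e (ws [ i ]≔ leaf)))) ]
           toℕ j ≡ toℕ (hole ws i) ×
           (∀ u → graft t (cast e (ws [ i ]≔ leaf)) ∘⟨ j ⟩ u ≡ graft t (cast e (ws [ i ]≔ u)))
  plug t refl ws i
    rewrite Vec.cast-is-id refl (ws [ i ]≔ leaf)
    = Fin.cast e j , Fin.toℕ-cast e j , λ u → begin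
        graft t′ (replicate _ leaf [ Fin.cast e j ]≔ u)         ≡⟨ cong (graft t′) (cast-replicate e j) ⟨
        graft t′ (cast e (replicate _ leaf [ j ]≔ u))           ≡⟨ graft-assoc t (ws [ i ]≔ leaf) _ e ⟩
        graft t (grafts (ws [ i ]≔ leaf) (replicate _ leaf [ j ]≔ u)) ≡⟨ cong (graft t) (grafts-hole ws i u) ⟩
        graft t (ws [ i ]≔ u)                                   ≡⟨ cong (graft t) (Vec.cast-is-id refl _) ⟨
        graft t (cast refl (ws [ i ]≔ u))                       ∎
    where
    open ≡.≡-Reasoning
    j  = hole ws i
    t′ = graft t (ws [ i ]≔ leaf)
    e  = ≡.sym (arity-graft t (ws [ i ]≔ leaf))

  private
    fill : ∀ {n} (Q : Vec A n → Set r) {d : A} → Q (replicate n d) →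
           (∀ ws i u → Q (ws [ i ]≔ d) → Q (ws [ i ]≔ u)) → ∀ us → Q us
    fill Q q₀ step []       = q₀
    fill Q {d} q₀ step (u ∷ us) = step (u ∷ us) zero u
      (fill (Q ∘ (d ∷_)) q₀ (λ ws i v → step (d ∷ ws) (suc i) v) us)

    replace : ∀ {n} {_≈_ : Rel A r} (R : Rel (Vec A n) r) → (∀ {us} → R us us) →
              (∀ {us vs ws} → R us vs → R vs ws → R us ws) →
              (∀ ws i {u v} → u ≈ v → R (ws [ i ]≔ u) (ws [ i ]≔ v)) →
              ∀ {us vs} → Pointwise _≈_ us vs → R us vs
    replace R rfl trn step []       = rfl
    replace R rfl trn step {u ∷ us} {v ∷ vs} (e ∷ es) = trn (step (u ∷ us) zero e)
      (replace (λ us vs → R (v ∷ us) (v ∷ vs)) rfl trn (λ ws i → step (v ∷ ws) (suc i)) es)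

    castˡ : ∀ {n} {_≈_ : Rel A r} {us : Vec A k} {vs : Vec A l} (e : k ≡ n) →
            Pointwise _≈_ us vs → Pointwise _≈_ (cast e us) vs
    castˡ {us = us} refl es = subst (λ us → Pointwise _ us _) (≡.sym (Vec.cast-is-id refl us)) es

  module _ (Γ : Congruence r) where
    open Congruence Γ
    open IsEquivalence isEquivalence renaming (refl to ≈-refl; sym to ≈-sym; trans to ≈-trans; reflexive to ≈-reflexive)

    graft-congʳ : ∀ t {us vs} → Pointwise _≈_ us vs → graft t us ≈ graft t vs
    graft-congʳ t = replace (λ us vs → graft t us ≈ graft t vs) ≈-refl ≈-trans step
      where
      step : ∀ ws i {u v} → u ≈ v → graft t (ws [ i ]≔ u) ≈ graft t (ws [ i ]≔ v)
      step ws i {u} {v} u≈v with plug t refl ws i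
      ... | j , _ , eq = ≈-trans (≈-reflexive (≡.sym (eq′ u))) (≈-trans (∘-congʳ (graft t (cast refl (ws [ i ]≔ leaf))) j u≈v) (≈-reflexive (eq′ v)))
        where
        eq′ : ∀ u → graft t (cast refl (ws [ i ]≔ leaf)) ∘⟨ j ⟩ u ≡ graft t (ws [ i ]≔ u)
        eq′ u = ≡.trans (eq u) (cong (graft t) (Vec.cast-is-id refl _))

    graft-congˡ : ∀ {t t′} (t≈t′ : t ≈ t′) us → graft t us ≈ graft t′ (cast (arity-cong t≈t′) us)
    graft-congˡ {t} {t′} t≈t′ us =
      subst (λ vs → graft t vs ≈ graft t′ (cast e us)) (Vec.cast-is-id refl us)
        (fill (λ us → graft t (cast refl us) ≈ graft t′ (cast e us)) start step us)
      where
      e = arity-cong t≈t′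

      cast-const : ∀ {k l} (e : k ≡ l) {y : Term} → cast e (replicate k y) ≡ replicate l y
      cast-const refl = Vec.cast-is-id refl _

      start : graft t (cast refl (replicate _ leaf)) ≈ graft t′ (cast e (replicate _ leaf))
      start rewrite cast-const {k = arity t} refl {leaf} | cast-const e {leaf}
                  | graft-identityʳ t | graft-identityʳ t′ = t≈t′

      step : ∀ ws i u → graft t (cast refl (ws [ i ]≔ leaf)) ≈ graft t′ (cast e (ws [ i ]≔ leaf)) →
             graft t (cast refl (ws [ i ]≔ u)) ≈ graft t′ (cast e (ws [ i ]≔ u))
      step ws i u h with plug t refl ws i | plug t′ e ws i
      ... | j , j≡ , eq | j′ , j′≡ , eq′ =
        ≈-trans (≈-reflexive (≡.sym (eq u)))
          (≈-trans (subst (λ j′ → graft t (cast refl (ws [ i ]≔ leaf)) ∘⟨ j ⟩ u ≈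
                                   graft t′ (cast e (ws [ i ]≔ leaf)) ∘⟨ j′ ⟩ u)
                     (Fin.toℕ-injective (≡.trans (Fin.toℕ-cast (arity-cong h) j) (≡.trans j≡ (≡.sym j′≡))))
                     (∘-congˡ h j u))
                   (≈-reflexive (eq′ u)))

    graft-cong : ∀ {t t′ us us′} → t ≈ t′ → Pointwise _≈_ us us′ → graft t us ≈ graft t′ us′
    graft-cong {t′ = t′} t≈t′ us≈us′ =
      ≈-trans (graft-congˡ t≈t′ _) (graft-congʳ t′ (castˡ (arity-cong t≈t′) us≈us′))

  arities-sum : (ts : Vec Term n) → arities ts ≡ sum (map arity ts)
  arities-sum []       = refl
  arities-sum (t ∷ ts) = cong (arity t +_) (arities-sum ts)

  degrees-sum : (ts : Vec Term n) → degrees ts ≡ sum (map degree ts)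
  degrees-sum []       = refl
  degrees-sum (t ∷ ts) = cong (degree t +_) (degrees-sum ts)

  private
    take-cast′ : ∀ k {l n} (xs : Vec A (k + l)) .(e : k + l ≡ k + n) → take k (cast e xs) ≡ take k xs
    take-cast′ zero    xs       e = refl
    take-cast′ (suc k) (x ∷ xs) e = cong (x ∷_) (take-cast′ k xs (ℕ.suc-injective e))

    drop-cast′ : ∀ k {l n} (xs : Vec A (k + l)) .(e : k + l ≡ k + n) .(e′ : l ≡ n) →
                 drop k (cast e xs) ≡ cast e′ (drop k xs)
    drop-cast′ zero    xs       e e′ = refl
    drop-cast′ (suc k) (x ∷ xs) e e′ = drop-cast′ k xs (ℕ.suc-injective e) e′

  grafts-composeAll : ∀ (us : Vec Term n) vs .(e : sum (map arity us) ≡ arities us) →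
                      grafts us (cast e vs) ≡ composeAll arity graft us vs
  grafts-composeAll []       vs e = refl
  grafts-composeAll (u ∷ us) vs e = cong₂ _∷_
    (cong (graft u) (take-cast′ (arity u) vs e))
    (≡.trans (cong (grafts us) (drop-cast′ (arity u) vs e e′)) (grafts-composeAll us _ e′))
    where e′ = ≡.sym (arities-sum us)

  arity-graft-sum : ∀ t us → arity (graft t us) ≡ sum (map arity us)
  arity-graft-sum t us = ≡.trans (arity-graft t us) (arities-sum us)

  graft-assoc-sum : ∀ t us vs →
    graft (graft t us) (cast (≡.sym (arity-graft-sum t us)) vs) ≡ graft t (composeAll arity graft us vs)
  graft-assoc-sum t us vs = begin
    graft (graft t us) (cast _ vs)            ≡⟨ cong (graft (graft t us)) (Vec.cast-trans e e′ vs) ⟨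
    graft (graft t us) (cast e′ (cast e vs))  ≡⟨ graft-assoc t us (cast e vs) e′ ⟩
    graft t (grafts us (cast e vs))           ≡⟨ cong (graft t) (grafts-composeAll us vs e) ⟩
    graft t (composeAll arity graft us vs)    ∎
    where
    open ≡.≡-Reasoning
    e  = ≡.sym (arities-sum us)
    e′ = ≡.sym (arity-graft t us)

  degree-graft-sum : ∀ t us → degree (graft t us) ≡ degree t + sum (map degree us)
  degree-graft-sum t us = ≡.trans (degree-graft t us) (cong (degree t +_) (degrees-sum us))

  degree≡0 : ∀ {t} → degree t ≡ 0 → t ≡ leaf
  degree≡0 {leaf} _ = refl

  pointwise-≡ : {us : Vec Term k} {vs : Vec Term l} (e : k ≡ l) →
                Pointwise _≡_ us vs → subst (Vec Term) e us ≡ vs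
  pointwise-≡ refl []       = refl
  pointwise-≡ refl (refl ∷ es) = cong (_ ∷_) (pointwise-≡ refl es)

  free : Operad a a
  free = record
    { setoid    = ≡.setoid Term
    ; ∣_∣       = arity
    ; 𝟏         = leaf
    ; _⟦_⟧      = graft
    ; ∣∣-cong   = cong arity
    ; ⟦⟧-cong   = λ { {x} refl es → cong (graft x) (pointwise-≡ refl es) }
    ; ∣𝟏∣       = refl
    ; ∣⟦⟧∣      = arity-graft-sum
    ; identityˡ = λ _ → refl
    ; identityʳ = graft-identityʳ
    ; assoc     = graft-assoc-sum
    }

  quotient : Congruence r → Operad a r
  quotient Γ = record
    { setoid    = record { isEquivalence = isEquivalence }
    ; ∣_∣       = arity
    ; 𝟏         = leaf
    ; _⟦_⟧      = graft
    ; ∣∣-cong   = arity-cong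
    ; ⟦⟧-cong   = graft-cong Γ
    ; ∣𝟏∣       = refl
    ; ∣⟦⟧∣      = arity-graft-sum
    ; identityˡ = λ _ → ≈.refl
    ; identityʳ = λ t → ≈.reflexive (graft-identityʳ t)
    ; assoc     = λ t us vs → ≈.reflexive (graft-assoc-sum t us vs)
    }
    where
    open Congruence Γ
    module ≈ = IsEquivalence isEquivalence

  freeGrading : Grading free
  freeGrading = record
    { deg      = degree
    ; deg-cong = cong degree
    ; deg-𝟏    = refl
    ; deg≡0⇒𝟏  = degree≡0
    ; deg-⟦⟧   = degree-graft-sum
    }

  quotientGrading : (Γ : Congruence r) → Congruence.CompatibleWithDegree Γ → Grading (quotient Γ)
  quotientGrading Γ compatible = record
    { deg      = degree
    ; deg-cong = compatible
    ; deg-𝟏    = refl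
    ; deg≡0⇒𝟏  = λ d → IsEquivalence.reflexive isEquivalence (degree≡0 d)
    ; deg-⟦⟧   = degree-graft-sum
    }
    where open Congruence Γ

  Cut : Set a
  Cut = Σ[ t ∈ Term ] Vec Term (arity t)

  Cuts : ℕ → Set a
  Cuts n = Σ[ ts ∈ Vec Term n ] Vec Term (arities ts)

  private
    under : ∀ s → Cuts (ar s) → Cut
    under s (ss , us) = node s ss , us

    beside : Cut → Cuts n → Cuts (suc n)
    beside (s , us) (ss , vs) = s ∷ ss , us ++ vs

  cuts  : Term → List Cut
  cuts′ : Vec Term n → List (Cuts n)
  cuts leaf        = (leaf , leaf ∷ []) ∷ []
  cuts (node s ts) = (leaf , node s ts ∷ []) ∷ List.map (under s) (cuts′ ts)
  cuts′ []       = ([] , []) ∷ []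
  cuts′ (t ∷ ts) = List.cartesianProductWith beside (cuts t) (cuts′ ts)

  graftCut : Cut → Term
  graftCut (s , us) = graft s us

  cuts-complete  : ∀ s us → (s , us) ∈ cuts (graft s us)
  cuts′-complete : ∀ (ss : Vec Term n) us → (ss , us) ∈ cuts′ (grafts ss us)
  cuts-complete leaf        (leaf ∷ [])      = here refl
  cuts-complete leaf        (node s ts ∷ []) = here refl
  cuts-complete (node s ss) us               = there (∈.∈-map⁺ (under s) (cuts′-complete ss us))
  cuts′-complete []       []       = here refl
  cuts′-complete (s ∷ ss) us       =
    subst (λ vs → (s ∷ ss , vs) ∈ cuts′ (grafts (s ∷ ss) us)) (Vec.take++drop≡id (arity s) us)
      (∈.∈-cartesianProductWith⁺ beside (cuts-complete s _) (cuts′-complete ss _))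

  cuts-sound  : ∀ t {c} → c ∈ cuts t → graftCut c ≡ t
  cuts′-sound : ∀ (ts : Vec Term n) {ss us} → (ss , us) ∈ cuts′ ts → grafts ss us ≡ ts
  cuts-sound leaf        (here refl) = refl
  cuts-sound (node s ts) (here refl) = refl
  cuts-sound (node s ts) (there q) with ∈.∈-map⁻ (under s) q
  ... | _ , q′ , refl = cong (node s) (cuts′-sound ts q′)
  cuts′-sound []       (here refl) = refl
  cuts′-sound (t ∷ ts) q with ∈.∈-cartesianProductWith⁻ beside (cuts t) (cuts′ ts) q
  ... | (s , us) , (ss , vs) , q₁ , q₂ , refl = cong₂ _∷_
    (≡.trans (cong (graft s) (take-++ us vs)) (cuts-sound t q₁))
    (≡.trans (cong (grafts ss) (drop-++ us vs)) (cuts′-sound ts q₂))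

  private
    under-injective : ∀ s {c d} → under s c ≡ under s d → c ≡ d
    under-injective s refl = refl

    beside-injective : ∀ {c d : Cut} {cs ds : Cuts n} → beside c cs ≡ beside d ds → c ≡ d × cs ≡ ds
    beside-injective {c = s , us} {s′ , us′} {ss , vs} {ss′ , vs′} eq =
      ≡.trans (cong (s ,_) (≡.sym (take-++ us vs))) (≡.trans (cong first eq) (cong (s′ ,_) (take-++ us′ vs′))) ,
      ≡.trans (cong (ss ,_) (≡.sym (drop-++ us vs))) (≡.trans (cong rest eq) (cong (ss′ ,_) (drop-++ us′ vs′)))
      where
      first : Cuts (suc k) → Cut
      first (s ∷ ss , ws) = s , take (arity s) ws
      rest : Cuts (suc k) → Cuts k
      rest (s ∷ ss , ws) = ss , drop (arity s) ws

  cuts-unique  : ∀ t → UniqueP.Unique (cuts t)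
  cuts′-unique : ∀ (ts : Vec Term n) → UniqueP.Unique (cuts′ ts)
  cuts-unique leaf        = [] ∷ []
  cuts-unique (node s ts) =
    All.tabulate (λ q → λ { refl → leaf∉ q }) ∷ UniqueP.map⁺ (under-injective s) (cuts′-unique ts)
    where
    leaf∉ : ∀ {us} → ¬ (leaf , us) ∈ List.map (under s) (cuts′ ts)
    leaf∉ q with ∈.∈-map⁻ (under s) q
    ... | _ , _ , ()
  cuts′-unique []       = [] ∷ []
  cuts′-unique (t ∷ ts) = UniqueP.cartesianProductWith⁺ beside beside-injective (cuts-unique t) (cuts′-unique ts)

  freeFinitelyFactorizable : FinitelyFactorizable free
  freeFinitelyFactorizable t = record
    { elements = cuts t
    ; sound    = All.tabulate (cuts-sound t)
    ; complete = λ { {s , us} refl → Any.map (λ { refl → F.refl }) (cuts-complete s us) }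
    ; unique   = AllPairs.map (λ c≢d c≈d → c≢d (≈⇒≡ c≈d)) (cuts-unique t)
    }
    where
    module F = Setoid (Operad.factorizationSetoid free)
    ≈⇒≡ : ∀ {c d} → c F.≈ d → c ≡ d
    ≈⇒≡ {s , us} (refl , es) = cong (s ,_) (pointwise-≡ refl es)

  module _ (Γ : Congruence r) (finite : Congruence.FiniteType Γ) where
    open Congruence Γ
    private
      module ≈ = IsEquivalence isEquivalence
      module Q = Operad (quotient Γ)
      module F = Setoid Q.factorizationSetoid
      module Class (t : Term) = Enumeration (finite t)

      classes : ∀ k → Vec Term l → List (Vec Term k)
      classes zero    []       = [] ∷ []
      classes (suc k) (t ∷ ts) = List.cartesianProductWith _∷_ (Class.elements t) (classes k ts)
      classes _       _        = []

      classes-complete : {ts : Vec Term l} {ts′ : Vec Term k} → Pointwise _≈_ ts ts′ → ts′ ∈ classes k ts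
      classes-complete []       = here refl
      classes-complete {ts = t ∷ _} (e ∷ es) =
        ∈.∈-cartesianProductWith⁺ _∷_ (Class.complete t (≈.sym e)) (classes-complete es)

      classes-sound : ∀ (ts : Vec Term l) {ts′ : Vec Term k} → ts′ ∈ classes k ts → Pointwise _≈_ ts ts′
      classes-sound {k = zero}  []       (here refl) = []
      classes-sound {k = suc k} (t ∷ ts) q
        with ∈.∈-cartesianProductWith⁻ _∷_ (Class.elements t) (classes k ts) q
      ... | _ , _ , q₁ , q₂ , refl = ≈.sym (All.lookup (Class.sound t) q₁) ∷ classes-sound ts q₂

      class : Cut → List Cut
      class (s , us) = List.concatMap (λ s′ → List.map (s′ ,_) (classes (arity s′) us)) (Class.elements s)

      class-complete : ∀ {c d} → c F.≈ d → d ∈ class c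
      class-complete {s , us} {s′ , us′} (e , es) = ∈.∈-concatMap⁺ _
        (Any.map (λ { refl → ∈.∈-map⁺ (s′ ,_) (classes-complete es) }) (Class.complete s (≈.sym e)))

      class-sound : ∀ {c d} → d ∈ class c → c F.≈ d
      class-sound {s , us} q with find (∈.∈-concatMap⁻ (λ s′ → List.map (s′ ,_) (classes (arity s′) us)) q)
      ... | s′ , q₁ , q₂ with ∈.∈-map⁻ (s′ ,_) q₂
      ...   | us′ , q₃ , refl = ≈.sym (All.lookup (Class.sound s) q₁) , classes-sound us q₃

      module At (t : Term) where
        candidates : List Cut
        candidates = List.concatMap cuts (Class.elements t)

        candidates-complete : ∀ {c} → graftCut c ≈ t → c ∈ candidates
        candidates-complete {s , us} e = ∈.∈-concatMap⁺ cuts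
          (Any.map (λ { refl → cuts-complete s us }) (Class.complete t e))

        candidates-sound : ∀ {c} → c ∈ candidates → graftCut c ≈ t
        candidates-sound {c} q with find (∈.∈-concatMap⁻ cuts {xs = Class.elements t} q)
        ... | t′ , q₁ , q₂ rewrite cuts-sound t′ q₂ = All.lookup (Class.sound t) q₁

        candidates-unique : UniqueP.Unique candidates
        candidates-unique = UniqueP.concat⁺ (All.map⁺ (All.universal cuts-unique _))
          (AllPairs.map⁺ {f = cuts} (AllPairs.map
            (λ {u} {v} u≢v {_} (q₁ , q₂) → u≢v (≡.trans (≡.sym (cuts-sound u q₁)) (cuts-sound v q₂)))
            (Class.unique t)))

        -- Neither Σ nor ≡ is assumed decidable: factorizations of
        -- equivalent terms are compared by their positions in `candidates`.

        compare : ∀ {c d} → graftCut c ≈ t → graftCut d ≈ t → Dec (c F.≈ d)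
        compare {c} {d} ec ed = map′ class-sound class-complete
          (search (All.tabulate λ q → ≈.trans (≈.sym (resp (class-sound {c} q))) ec))
          where
          resp : ∀ {c d} → c F.≈ d → graftCut c ≈ graftCut d
          resp (e , es) = graft-cong Γ e es
          search : ∀ {ds} → All (λ d → graftCut d ≈ t) ds → Dec (d ∈ ds)
          search [] = no λ ()
          search {d′ ∷ _} (e ∷ es)
            with unique⇒≟ candidates-unique (candidates-complete {d} ed) (candidates-complete {d′} e)
          ... | yes d≡ = yes (here d≡)
          ... | no  d≢ = map′ there (λ { (here d≡) → ⊥-elim (d≢ d≡) ; (there q) → q }) (search es)

    quotientFinitelyFactorizable : FinitelyFactorizable (quotient Γ)
    quotientFinitelyFactorizable t = dedupe Q.factorizationSetoid (Q._factorizes t) (λ {c} {d} → compare {c} {d})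
      candidates (All.tabulate candidates-sound)
      (λ {c} e → Any.map (λ { refl → F.refl }) (candidates-complete {c} e))
      where open At t

module Linear (R : CommutativeRing c ℓ) where
  open CommutativeRing R using (0#; 1#; -_; -‿inverseˡ)
    renaming (Carrier to K; _≈_ to _≈ᴷ_; _+_ to _+ᴷ_; _*_ to _*ᴷ_)
  private
    module R = CommutativeRing R

  infixl 6 _⊕_
  infixr 7 _⊙_
  infix  4 _∼_

  data Combination (X : Set x) : Set (c ⊔ x) where
    gen : X → Combination X
    𝟘   : Combination X
    _⊕_ : Combination X → Combination X → Combination X
    _⊙_ : K → Combination X → Combination X

  -- The module generated by X subject to the relations _∼_.

  data Equal {X : Set x} (_∼_ : Rel (Combination X) r) : Rel (Combination X) (c ⊔ ℓ ⊔ x ⊔ r) where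
    rel         : ∀ {u v} → u ∼ v → Equal _∼_ u v
    reflexivity : ∀ {u} → Equal _∼_ u u
    symmetry    : ∀ {u v} → Equal _∼_ u v → Equal _∼_ v u
    transitive  : ∀ {u v w} → Equal _∼_ u v → Equal _∼_ v w → Equal _∼_ u w
    ⊕-cong      : ∀ {u u′ v v′} → Equal _∼_ u u′ → Equal _∼_ v v′ → Equal _∼_ (u ⊕ v) (u′ ⊕ v′)
    ⊕-assoc     : ∀ u v w → Equal _∼_ ((u ⊕ v) ⊕ w) (u ⊕ (v ⊕ w))
    ⊕-comm      : ∀ u v → Equal _∼_ (u ⊕ v) (v ⊕ u)
    ⊕-identityˡ : ∀ u → Equal _∼_ (𝟘 ⊕ u) u
    ⊙-cong      : ∀ {k k′ u u′} → k ≈ᴷ k′ → Equal _∼_ u u′ → Equal _∼_ (k ⊙ u) (k′ ⊙ u′)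
    ⊙-zeroˡ     : ∀ u → Equal _∼_ (0# ⊙ u) 𝟘
    ⊙-zeroʳ     : ∀ k → Equal _∼_ (k ⊙ 𝟘) 𝟘
    ⊙-identityˡ : ∀ u → Equal _∼_ (1# ⊙ u) u
    ⊙-assoc     : ∀ k k′ u → Equal _∼_ ((k *ᴷ k′) ⊙ u) (k ⊙ (k′ ⊙ u))
    ⊙-distribˡ  : ∀ k u v → Equal _∼_ (k ⊙ (u ⊕ v)) (k ⊙ u ⊕ k ⊙ v)
    ⊙-distribʳ  : ∀ u k k′ → Equal _∼_ ((k +ᴷ k′) ⊙ u) (k ⊙ u ⊕ k′ ⊙ u)

  presented : {X : Set x} → Rel (Combination X) r → Module R (c ⊔ x) (c ⊔ ℓ ⊔ x ⊔ r)
  presented {X = X} _∼_ = record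
    { Carrierᴹ = Combination X
    ; _≈ᴹ_     = Equal _∼_
    ; _+ᴹ_     = _⊕_
    ; _*ₗ_     = _⊙_
    ; _*ᵣ_     = flip _⊙_
    ; 0ᴹ       = 𝟘
    ; -ᴹ_      = (- 1#) ⊙_
    ; isModule = IsModuleFromLeft.isModule {commutativeRing = R} (record { isLeftModule = record
      { isLeftSemimodule = record
        { +ᴹ-isCommutativeMonoid = record
          { isMonoid = record
            { isSemigroup = record
              { isMagma = record
                { isEquivalence = record { refl = reflexivity ; sym = symmetry ; trans = transitive }
                ; ∙-cong        = ⊕-cong
                }
              ; assoc = ⊕-assoc
              }
            ; identity = ⊕-identityˡ , λ u → transitive (⊕-comm u 𝟘) (⊕-identityˡ u)
            }
          ; comm = ⊕-comm
          }
        ; isPreleftSemimodule = record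
          { *ₗ-cong      = ⊙-cong
          ; *ₗ-zeroˡ     = ⊙-zeroˡ
          ; *ₗ-distribʳ  = ⊙-distribʳ
          ; *ₗ-identityˡ = ⊙-identityˡ
          ; *ₗ-assoc     = ⊙-assoc
          ; *ₗ-zeroʳ     = ⊙-zeroʳ
          ; *ₗ-distribˡ  = ⊙-distribˡ
          }
        }
      ; -ᴹ‿cong    = ⊙-cong R.refl
      ; -ᴹ‿inverse = inverseˡ , λ u → transitive (⊕-comm u _) (inverseˡ u)
      } })
    }
    where
    inverseˡ : ∀ u → Equal _∼_ ((- 1#) ⊙ u ⊕ u) 𝟘
    inverseˡ u = transitive (⊕-cong reflexivity (symmetry (⊙-identityˡ u)))
      (transitive (symmetry (⊙-distribʳ u (- 1#) 1#))
        (transitive (⊙-cong (-‿inverseˡ 1#) reflexivity) (⊙-zeroˡ u)))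

  data _∼_ {S : Setoid x r} : Rel (Combination (Setoid.Carrier S)) (c ⊔ x ⊔ r) where
    gen-cong : ∀ {y z} → Setoid._≈_ S y z → gen y ∼ gen z

  Free : Setoid x r → Module R (c ⊔ x) (c ⊔ ℓ ⊔ x ⊔ r)
  Free S = presented (_∼_ {S = S})

  module _ (M : Module R m n′) (N : Module R m′ r) where
    private
      module M = Module M
      module N = Module N

    -- In M ⊗ N, `gen (u , v)` is the pure tensor u ⊗ v.

    data Bilinear : Rel (Combination (M.Carrierᴹ × N.Carrierᴹ)) (c ⊔ m ⊔ n′ ⊔ m′ ⊔ r) where
      ⊗-cong     : ∀ {u u′ v v′} → u M.≈ᴹ u′ → v N.≈ᴹ v′ → Bilinear (gen (u , v)) (gen (u′ , v′))
      ⊗-distribʳ : ∀ u u′ v → Bilinear (gen (u M.+ᴹ u′ , v)) (gen (u , v) ⊕ gen (u′ , v))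
      ⊗-distribˡ : ∀ u v v′ → Bilinear (gen (u , v N.+ᴹ v′)) (gen (u , v) ⊕ gen (u , v′))
      ⊗-scaleˡ   : ∀ k u v → Bilinear (gen (k M.*ₗ u , v)) (k ⊙ gen (u , v))
      ⊗-scaleʳ   : ∀ k u v → Bilinear (gen (u , k N.*ₗ v)) (k ⊙ gen (u , v))

    infixr 7 _⊗_
    _⊗_ : Module R (c ⊔ m ⊔ m′) (c ⊔ ℓ ⊔ m ⊔ m′ ⊔ n′ ⊔ r)
    _⊗_ = presented Bilinear

  extend : {X : Set x} (M : Module R m n′) → (X → Module.Carrierᴹ M) → Combination X → Module.Carrierᴹ M
  extend M f (gen y) = f y
  extend M f 𝟘       = Module.0ᴹ M
  extend M f (u ⊕ v) = Module._+ᴹ_ M (extend M f u) (extend M f v)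
  extend M f (k ⊙ u) = Module._*ₗ_ M k (extend M f u)

  ∑ : {X : Set x} (M : Module R m n′) → List X → (X → Module.Carrierᴹ M) → Module.Carrierᴹ M
  ∑ M ys f = List.foldr (λ y s → Module._+ᴹ_ M (f y) s) (Module.0ᴹ M) ys

  record RawBialgebra m n′ : Set (lsuc (c ⊔ ℓ ⊔ m ⊔ n′)) where
    infixl 7 _∙_
    field
      space : Module R m n′
    open Module space public
    field
      _∙_ : Carrierᴹ → Carrierᴹ → Carrierᴹ
      𝟏ᴴ  : Carrierᴹ
      Δ   : Carrierᴹ → Module.Carrierᴹ (space ⊗ space)
      ε   : Carrierᴹ → K

    IsLinear : (Carrierᴹ → Carrierᴹ) → Set (c ⊔ m ⊔ n′)
    IsLinear = ModuleMorphisms.IsModuleHomomorphism rawModule rawModule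

    convolve : (f g : Carrierᴹ → Carrierᴹ) → Carrierᴹ → Carrierᴹ
    convolve f g u = extend space (λ (v , w) → f v ∙ g w) (Δ u)

    record IsAntipode (S : Carrierᴹ → Carrierᴹ) : Set (c ⊔ m ⊔ n′) where
      field
        isLinear : IsLinear S
        inverseˡ : ∀ u → convolve S id u ≈ᴹ ε u *ₗ 𝟏ᴴ
        inverseʳ : ∀ u → convolve id S u ≈ᴹ ε u *ₗ 𝟏ᴴ

  -- An antipode is unique when it exists, so it is not part of RawBialgebra:
  -- S-homo quantifies over the antipodes of both sides.

  record IsHopfMorphism (H : RawBialgebra m n′) (H′ : RawBialgebra m′ r)
                        (φ : RawBialgebra.Carrierᴹ H → RawBialgebra.Carrierᴹ H′) :
                        Set (c ⊔ ℓ ⊔ m ⊔ n′ ⊔ m′ ⊔ r) where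
    private
      module H  = RawBialgebra H
      module H′ = RawBialgebra H′
      H′⊗H′     = H′.space ⊗ H′.space
    field
      isLinear   : ModuleMorphisms.IsModuleHomomorphism H.rawModule H′.rawModule φ
      ∙-homo     : ∀ u v → φ (u H.∙ v) H′.≈ᴹ φ u H′.∙ φ v
      𝟏-homo     : φ H.𝟏ᴴ H′.≈ᴹ H′.𝟏ᴴ
      Δ-homo     : ∀ u → Module._≈ᴹ_ H′⊗H′ (H′.Δ (φ u)) (extend H′⊗H′ (λ (v , w) → gen (φ v , φ w)) (H.Δ u))
      ε-homo     : ∀ u → H′.ε (φ u) ≈ᴷ H.ε u
      S-homo     : ∀ {S S′} → H.IsAntipode S → H′.IsAntipode S′ → ∀ u → φ (S u) H′.≈ᴹ S′ (φ u)

  module Natural (O : Operad o r) (grading : Grading O) (factorizations : FinitelyFactorizable O) where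
    open Operad O using (Carrier; setoid; 𝟏; _≈_)
    open Grading grading using (_≟𝟏)

    letterSetoid : Setoid (o ⊔ r) r
    letterSetoid = On.setoid {B = Σ[ y ∈ Carrier ] ¬ y ≈ 𝟏} setoid proj₁

    open ListEquality letterSetoid using () renaming (≋-setoid to reducedWordSetoid) public

    ReducedWord : Set (o ⊔ r)
    ReducedWord = Setoid.Carrier reducedWordSetoid

    rd : List Carrier → ReducedWord
    rd []       = []
    rd (y ∷ ys) with y ≟𝟏
    ... | yes _   = rd ys
    ... | no  y≉𝟏 = (y , y≉𝟏) ∷ rd ys

    N : Module R (c ⊔ o ⊔ r) (c ⊔ ℓ ⊔ o ⊔ r)
    N = Free reducedWordSetoid

    private
      V = Combination ReducedWord

    E : ReducedWord → V
    E = gen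

    _∙_ : V → V → V
    u ∙ v = extend N (λ w₁ → extend N (λ w₂ → E (w₁ List.++ w₂)) v) u

    _∙⊗_ : (p q : Combination (V × V)) → Combination (V × V)
    p ∙⊗ q = extend (N ⊗ N) (λ (u , v) → extend (N ⊗ N) (λ (u′ , v′) → gen (u ∙ u′ , v ∙ v′)) q) p

    Δ-letter : Carrier → Combination (V × V)
    Δ-letter y = ∑ (N ⊗ N) (Enumeration.elements (factorizations y))
      λ (z , zs) → gen (E (rd (z ∷ [])) , E (rd (Vec.toList zs)))

    Δ-word : ReducedWord → Combination (V × V)
    Δ-word []            = gen (E [] , E [])
    Δ-word ((y , _) ∷ w) = Δ-letter y ∙⊗ Δ-word w

    ε-word : ReducedWord → K
    ε-word []      = 1#
    ε-word (_ ∷ _) = 0#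

    natural : RawBialgebra (c ⊔ o ⊔ r) (c ⊔ ℓ ⊔ o ⊔ r)
    natural = record
      { space = N
      ; _∙_   = _∙_
      ; 𝟏ᴴ    = E []
      ; Δ     = extend (N ⊗ N) Δ-word
      ; ε     = extend TensorUnit.⟨module⟩ ε-word
      }

ring : HeytingField c ℓ₁ ℓ₂ → CommutativeRing c ℓ₁
ring K = HeytingCommutativeRing.commutativeRing (HeytingField.heytingCommutativeRing K)

-- Stated with the field's apartness #; classically # is ≉.

CharacteristicZero : HeytingField c ℓ₁ ℓ₂ → Set ℓ₂
CharacteristicZero K = ∀ n → (suc n · 1#) # 0#
  where
  open HeytingField K using (_#_; 0#; 1#)
  open Mult (CommutativeRing.+-monoid (ring K)) using () renaming (_×_ to _·_)

open Terms using (Congruence; free; quotient) public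
open Congruence using (CompatibleWithDegree; FiniteType) public

module Theorem (K : HeytingField c ℓ₁ ℓ₂) (Sig : Signature a) (Γ : Congruence Sig r)
               (compatible : CompatibleWithDegree Γ) (finite : FiniteType Γ) where
  open Terms Sig using (freeGrading; freeFinitelyFactorizable; quotientGrading; quotientFinitelyFactorizable)
  open Linear (ring K) using (RawBialgebra; extend; ∑; module Natural)
  open Linear (ring K) using (IsHopfMorphism) public

  module NT  = Natural (free Sig) freeGrading freeFinitelyFactorizable
  module NT≡ = Natural (quotient Sig Γ) (quotientGrading Γ compatible) (quotientFinitelyFactorizable Γ finite)

  N[T] : RawBialgebra (c ⊔ a) (c ⊔ ℓ₁ ⊔ a)
  N[T] = NT.natural

  N[T/≡] : RawBialgebra (c ⊔ a ⊔ r) (c ⊔ ℓ₁ ⊔ a ⊔ r)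
  N[T/≡] = NT≡.natural

  open RawBialgebra N[T] using () renaming (_≈ᴹ_ to _≈ᴺᵀ_) public
  open RawBialgebra N[T/≡] using () renaming (_≈ᴹ_ to _≈ᴺᵀᐟ≡_) public

  -- The quotient is a setoid, so the projection is the identity on
  -- underlying terms; only the equality changes.

  π : List (Operad.Carrier (free Sig)) → List (Operad.Carrier (quotient Sig Γ))
  π = List.map id

  _π≡_ : NT.ReducedWord → NT≡.ReducedWord → Set (a ⊔ r)
  f π≡ x = π (List.map proj₁ f) ≋ List.map proj₁ x
    where open ListEquality (Operad.setoid (quotient Sig Γ)) using (_≋_)

  Fibre : NT≡.ReducedWord → Set (a ⊔ r)
  Fibre x = Enumeration NT.reducedWordSetoid (_π≡ x)

  φ : (∀ x → Fibre x) → RawBialgebra.Carrierᴹ N[T/≡] → RawBialgebra.Carrierᴹ N[T]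
  φ fibre = extend NT.N λ x → ∑ NT.N (Enumeration.elements (fibre x)) NT.E

{-# OPTIONS --safe #-}

-- For a word w of terms let Φ(w) be the sum of the E_{rd(f)} over all forests f with
-- π(f) = π(w).  A class of forests is the product of the classes of its letters, so Φ is
-- multiplicative; since the class of the leaf is a singleton, φ(E_{rd(π(w))}) = Φ(w).
-- The factorizations of the terms of a class are exactly the lifts of the factorizations
-- of that class, which gives compatibility with the coproduct on letters, hence on words.
-- Compatibility with antipodes uses only that Δ(E_x) is E_x ⊗ 1 plus terms whose left factor
-- has smaller degree.  In characteristic zero, E_f ↦ |π⁻¹(π(f))|⁻¹ E_{π(f)} is a left
-- inverse of φ.

module Submission where

open import Algebra.Apartness.Bundles using (HeytingField)
open import Algebra.Bundles using (CommutativeMonoid; CommutativeRing)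
open import Algebra.Module.Bundles using (Module)
import Algebra.Module.Construct.TensorUnit as TensorUnit
open import Algebra.Module.Morphism.Structures using (module ModuleMorphisms)
import Algebra.Properties.CommutativeSemigroup as CommutativeSemigroupProperties
import Algebra.Properties.Group as GroupProperties
import Algebra.Properties.Monoid.Mult as Mult
open import Data.Empty using (⊥-elim)
open import Data.List as List using (List; []; _∷_; _++_; cartesianProductWith)
open import Data.List.Membership.Propositional using (_∈_; find)
import Data.List.Membership.Propositional.Properties as ∈
open import Data.List.Membership.Propositional.Properties.WithK using (unique∧set⇒bag)
import Data.List.Properties as List
open import Data.List.Relation.Binary.BagAndSetEquality using (∼bag⇒↭)
open import Data.List.Relation.Binary.Permutation.Propositional as ↭ using (_↭_)
open import Data.List.Relation.Binary.Permutation.Propositional.Properties using (↭-length)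
open import Data.List.Relation.Binary.Pointwise as ListPointwise using ([]; _∷_) renaming (Pointwise to ListPointwise)
open import Data.List.Relation.Unary.All as All using (All; []; _∷_)
import Data.List.Relation.Unary.All.Properties as All
open import Data.List.Relation.Unary.AllPairs as AllPairs using (AllPairs; []; _∷_)
import Data.List.Relation.Unary.AllPairs.Properties as AllPairs
open import Data.List.Relation.Unary.Any as Any using (Any; here; there)
open import Data.List.Relation.Unary.Unique.Propositional using (Unique)
import Data.List.Relation.Unary.Unique.Propositional.Properties as Unique
open import Data.Nat using (ℕ; zero; suc; _+_; _≤_; _<_; z≤n; s≤s)
open import Data.Nat.Induction using (<-wellFounded)
import Data.Nat.Properties as ℕ
open import Data.Product using (_×_; _,_; proj₁; proj₂; ∃-syntax; uncurry)
open import Data.Vec as Vec using (Vec; []; _∷_)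
import Data.Vec.Properties as Vec
open import Data.Vec.Relation.Binary.Pointwise.Inductive using (Pointwise; []; _∷_)
open import Function using (_∘_; id; mk⇔)
open import Function.Definitions using (Injective)
open import Induction.WellFounded using (Acc; acc)
open import Level using (Level; _⊔_)
open import Relation.Binary using (IsEquivalence; Rel; Setoid)
open import Relation.Binary.PropositionalEquality as ≡ using (_≡_; refl)
import Relation.Binary.Reasoning.Setoid as SetoidReasoning
open import Relation.Nullary using (¬_; Dec; yes; no)
open import Relation.Unary using (Pred)
open import Defs

-- A fibre, a class and the factorizations of a term are given only as duplicate-free lists, and
-- neither the signature nor the congruence is assumed decidable, so two sums over the same set may
-- run through different lists. Such lists are brought into a type with propositional equality,
-- where having the same members makes them permutations of each other. The elements of an arbitrary
-- `fibre` are treated this way in `φ-E`; from there on the explicit lists `forests` replace them.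
-- Antipodes are not constructed: compatibility is claimed for whatever antipodes the two sides
-- have, so no recursive formula for them is at hand. The law S * id = ε is instead solved for
-- S(E_x): the summand E_x ⊗ 1 of Δ(E_x) contributes S(E_x) itself, while every other summand
-- involves S only at a word of smaller degree.

private
  variable
    a b c d ℓ ℓ₁ ℓ₂ m n o p q r s t u : Level
    A : Set a
    k l : ℕ

-- Without duplicates every multiplicity is 0 or 1, so lists with equal sets of members are already
-- equal as multisets.
unique-↭ : {xs ys : List A} → Unique xs → Unique ys →
           (∀ {z} → z ∈ xs → z ∈ ys) → (∀ {z} → z ∈ ys → z ∈ xs) → xs ↭ ys
unique-↭ xs! ys! ⊆ ⊇ = ∼bag⇒↭ (unique∧set⇒bag xs! ys! (mk⇔ ⊆ ⊇))

-- Linear maps, bilinear maps and finite sums in presented modules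

module LinearProperties (R : CommutativeRing c ℓ) where
  open CommutativeRing R using (0#; 1#; -_) renaming (Carrier to K)
  open Linear R

  -- Only the laws from which the others follow: zero is preserved because it is the multiple by
  -- `0#`, negatives because they are multiples by `- 1#`.
  record IsLinearMap (M : Module R m n) (N : Module R p q)
                     (f : Module.Carrierᴹ M → Module.Carrierᴹ N) : Set (c ⊔ m ⊔ n ⊔ q) where
    private
      module M = Module M
      module N = Module N
    field
      ⟦⟧-cong : ∀ {x y} → x M.≈ᴹ y → f x N.≈ᴹ f y
      +-homo  : ∀ x y → f (x M.+ᴹ y) N.≈ᴹ f x N.+ᴹ f y
      *-homo  : ∀ k x → f (k M.*ₗ x) N.≈ᴹ k N.*ₗ f x

    0-homo : f M.0ᴹ N.≈ᴹ N.0ᴹ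
    0-homo = N.≈ᴹ-trans (⟦⟧-cong (M.≈ᴹ-sym (M.*ₗ-zeroˡ M.0ᴹ)))
      (N.≈ᴹ-trans (*-homo 0# M.0ᴹ) (N.*ₗ-zeroˡ (f M.0ᴹ)))

  module _ {M : Module R m n} {N : Module R p q} {f : Module.Carrierᴹ M → Module.Carrierᴹ N} where
    private
      module M = Module M
      module N = Module N
    open ModuleMorphisms M.rawModule N.rawModule using (IsModuleHomomorphism)

    fromHomomorphism : IsModuleHomomorphism f → IsLinearMap M N f
    fromHomomorphism h = record { ⟦⟧-cong = h.⟦⟧-cong ; +-homo = h.+ᴹ-homo ; *-homo = h.*ₗ-homo }
      where module h = IsModuleHomomorphism h

  linear-∘ : {L : Module R m n} {M : Module R p q} {N : Module R r s}
             {f : Module.Carrierᴹ M → Module.Carrierᴹ N} {g : Module.Carrierᴹ L → Module.Carrierᴹ M} →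
             IsLinearMap M N f → IsLinearMap L M g → IsLinearMap L N (f ∘ g)
  linear-∘ {N = N} F G = record
    { ⟦⟧-cong = F.⟦⟧-cong ∘ G.⟦⟧-cong
    ; +-homo  = λ x y → N.≈ᴹ-trans (F.⟦⟧-cong (G.+-homo x y)) (F.+-homo _ _)
    ; *-homo  = λ k x → N.≈ᴹ-trans (F.⟦⟧-cong (G.*-homo k x)) (F.*-homo k _)
    }
    where
    module N = Module N
    module F = IsLinearMap F
    module G = IsLinearMap G

  record IsBilinearMap (L : Module R m n) (M : Module R p q) (N : Module R r s)
                       (f : Module.Carrierᴹ L → Module.Carrierᴹ M → Module.Carrierᴹ N) :
                       Set (c ⊔ m ⊔ n ⊔ p ⊔ q ⊔ s) where
    field
      linearˡ : ∀ y → IsLinearMap L N (λ x → f x y)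
      linearʳ : ∀ x → IsLinearMap M N (f x)

    cong₂ : ∀ {x x′ y y′} → Module._≈ᴹ_ L x x′ → Module._≈ᴹ_ M y y′ → Module._≈ᴹ_ N (f x y) (f x′ y′)
    cong₂ e e′ = Module.≈ᴹ-trans N (IsLinearMap.⟦⟧-cong (linearˡ _) e) (IsLinearMap.⟦⟧-cong (linearʳ _) e′)

  module _ (M : Module R m n) where
    open Module M

    extend-ext : {X : Set a} {f g : X → Carrierᴹ} → (∀ x → f x ≈ᴹ g x) →
                 ∀ v → extend M f v ≈ᴹ extend M g v
    extend-ext f≈g (gen x) = f≈g x
    extend-ext f≈g 𝟘       = ≈ᴹ-refl
    extend-ext f≈g (v ⊕ w) = +ᴹ-cong (extend-ext f≈g v) (extend-ext f≈g w)
    extend-ext f≈g (k ⊙ v) = *ₗ-cong (CommutativeRing.refl R) (extend-ext f≈g v)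

    -- Universal property of a presentation: all constructors of `Equal` except `rel` express an
    -- equivalence, a congruence or a module axiom, which hold in `M`, so only the defining
    -- relations have to be checked.
    extend-cong : {X : Set a} {f : X → Carrierᴹ} {_∼_ : Rel (Combination X) r} →
                  (∀ {v w} → v ∼ w → extend M f v ≈ᴹ extend M f w) →
                  ∀ {v w} → Equal _∼_ v w → extend M f v ≈ᴹ extend M f w
    extend-cong h (rel e)              = h e
    extend-cong h reflexivity          = ≈ᴹ-refl
    extend-cong h (symmetry e)         = ≈ᴹ-sym (extend-cong h e)
    extend-cong h (transitive e e′)    = ≈ᴹ-trans (extend-cong h e) (extend-cong h e′)
    extend-cong h (⊕-cong e e′)        = +ᴹ-cong (extend-cong h e) (extend-cong h e′)
    extend-cong h (⊕-assoc v w x)      = +ᴹ-assoc _ _ _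
    extend-cong h (⊕-comm v w)         = +ᴹ-comm _ _
    extend-cong h (⊕-identityˡ v)      = +ᴹ-identityˡ _
    extend-cong h (⊙-cong k≈ e)        = *ₗ-cong k≈ (extend-cong h e)
    extend-cong h (⊙-zeroˡ v)          = *ₗ-zeroˡ _
    extend-cong h (⊙-zeroʳ k)          = *ₗ-zeroʳ k
    extend-cong h (⊙-identityˡ v)      = *ₗ-identityˡ _
    extend-cong h (⊙-assoc k k′ v)     = *ₗ-assoc k k′ _
    extend-cong h (⊙-distribˡ k v w)   = *ₗ-distribˡ k _ _
    extend-cong h (⊙-distribʳ v k k′)  = *ₗ-distribʳ _ k k′

    extend-linear : {X : Set a} {f : X → Carrierᴹ} {_∼_ : Rel (Combination X) r} →
                    (∀ {v w} → v ∼ w → extend M f v ≈ᴹ extend M f w) →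
                    IsLinearMap (presented _∼_) M (extend M f)
    extend-linear h = record
      { ⟦⟧-cong = extend-cong h ; +-homo = λ _ _ → ≈ᴹ-refl ; *-homo = λ _ _ → ≈ᴹ-refl }

    free-linear : {S : Setoid a b} {f : Setoid.Carrier S → Carrierᴹ} →
                  (∀ {x y} → Setoid._≈_ S x y → f x ≈ᴹ f y) → IsLinearMap (Free S) M (extend M f)
    free-linear {S = S} {f} h = extend-linear resp
      where
      resp : ∀ {v w} → _∼_ {S = S} v w → extend M f v ≈ᴹ extend M f w
      resp (gen-cong e) = h e

  linear-unique : {X : Set a} {_∼_ : Rel (Combination X) r} {M : Module R m n}
                  {f g : Combination X → Module.Carrierᴹ M} →
                  IsLinearMap (presented _∼_) M f → IsLinearMap (presented _∼_) M g →
                  (∀ x → Module._≈ᴹ_ M (f (gen x)) (g (gen x))) → ∀ v → Module._≈ᴹ_ M (f v) (g v)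
  linear-unique {M = M} F G f≈g = go
    where
    open Module M
    module F = IsLinearMap F
    module G = IsLinearMap G
    go : ∀ v → _
    go (gen x) = f≈g x
    go 𝟘       = ≈ᴹ-trans F.0-homo (≈ᴹ-sym G.0-homo)
    go (v ⊕ w) = ≈ᴹ-trans (F.+-homo v w) (≈ᴹ-trans (+ᴹ-cong (go v) (go w)) (≈ᴹ-sym (G.+-homo v w)))
    go (k ⊙ v) = ≈ᴹ-trans (F.*-homo k v)
      (≈ᴹ-trans (*ₗ-cong (CommutativeRing.refl R) (go v)) (≈ᴹ-sym (G.*-homo k v)))

  linear-extend : {M : Module R m n} {N : Module R p q} {h : Module.Carrierᴹ M → Module.Carrierᴹ N} →
                  IsLinearMap M N h → {X : Set a} {f : X → Module.Carrierᴹ M} →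
                  ∀ v → Module._≈ᴹ_ N (h (extend M f v)) (extend N (h ∘ f) v)
  linear-extend {N = N} H = go
    where
    open Module N
    open IsLinearMap H
    go : ∀ v → _
    go (gen x) = ≈ᴹ-refl
    go 𝟘       = 0-homo
    go (v ⊕ w) = ≈ᴹ-trans (+-homo _ _) (+ᴹ-cong (go v) (go w))
    go (k ⊙ v) = ≈ᴹ-trans (*-homo k _) (*ₗ-cong (CommutativeRing.refl R) (go v))

  zero-linear : {M : Module R m n} {N : Module R p q} → IsLinearMap M N (λ _ → Module.0ᴹ N)
  zero-linear {N = N} = record
    { ⟦⟧-cong = λ _ → ≈ᴹ-refl
    ; +-homo  = λ _ _ → ≈ᴹ-sym (+ᴹ-identityˡ 0ᴹ)
    ; *-homo  = λ k _ → ≈ᴹ-sym (*ₗ-zeroʳ k)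
    }
    where open Module N

  +-linear : {M : Module R m n} {N : Module R p q} {f g : Module.Carrierᴹ M → Module.Carrierᴹ N} →
             IsLinearMap M N f → IsLinearMap M N g → IsLinearMap M N (λ x → Module._+ᴹ_ N (f x) (g x))
  +-linear {N = N} F G = record
    { ⟦⟧-cong = λ e → +ᴹ-cong (F.⟦⟧-cong e) (G.⟦⟧-cong e)
    ; +-homo  = λ x y → ≈ᴹ-trans (+ᴹ-cong (F.+-homo x y) (G.+-homo x y)) (interchange _ _ _ _)
    ; *-homo  = λ k x → ≈ᴹ-trans (+ᴹ-cong (F.*-homo k x) (G.*-homo k x)) (≈ᴹ-sym (*ₗ-distribˡ k _ _))
    }
    where
    open Module N
    open CommutativeSemigroupProperties
      (CommutativeMonoid.commutativeSemigroup +ᴹ-commutativeMonoid) using (interchange)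
    module F = IsLinearMap F
    module G = IsLinearMap G

  *-linear : {M : Module R m n} {N : Module R p q} {f : Module.Carrierᴹ M → Module.Carrierᴹ N} (k : K) →
             IsLinearMap M N f → IsLinearMap M N (λ x → Module._*ₗ_ N k (f x))
  *-linear {N = N} k F = record
    { ⟦⟧-cong = λ e → *ₗ-cong R.refl (F.⟦⟧-cong e)
    ; +-homo  = λ x y → ≈ᴹ-trans (*ₗ-cong R.refl (F.+-homo x y)) (*ₗ-distribˡ k _ _)
    ; *-homo  = λ k′ x → ≈ᴹ-trans (*ₗ-cong R.refl (F.*-homo k′ x)) (≈ᴹ-trans (≈ᴹ-sym (*ₗ-assoc k k′ _))
                          (≈ᴹ-trans (*ₗ-cong (R.*-comm k k′) ≈ᴹ-refl) (*ₗ-assoc k′ k _)))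
    }
    where
    open Module N
    module R = CommutativeRing R
    module F = IsLinearMap F

  -- Linear maps are closed under linear combinations. This gives the linearity of `_∙_` and `_∙⊗_`
  -- in the argument on which the outer `extend` does not recurse.
  extend-linearʳ : {M : Module R m n} {N : Module R p q} {X : Set a}
                   {f : X → Module.Carrierᴹ M → Module.Carrierᴹ N} →
                   (∀ x → IsLinearMap M N (f x)) →
                   ∀ v → IsLinearMap M N (λ y → extend N (λ x → f x y) v)
  extend-linearʳ F (gen x) = F x
  extend-linearʳ F 𝟘       = zero-linear
  extend-linearʳ F (v ⊕ w) = +-linear (extend-linearʳ F v) (extend-linearʳ F w)
  extend-linearʳ F (k ⊙ v) = *-linear k (extend-linearʳ F v)

  module _ {M : Module R m n} {N : Module R p q} where
    private
      module M = Module M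
      module N = Module N

    ⊗-bilinear : IsBilinearMap M N (M ⊗ N) (λ x y → gen (x , y))
    ⊗-bilinear = record
      { linearˡ = λ y → record
        { ⟦⟧-cong = λ e → rel (⊗-cong e N.≈ᴹ-refl)
        ; +-homo  = λ x x′ → rel (⊗-distribʳ x x′ y)
        ; *-homo  = λ k x → rel (⊗-scaleˡ k x y)
        }
      ; linearʳ = λ x → record
        { ⟦⟧-cong = λ e → rel (⊗-cong M.≈ᴹ-refl e)
        ; +-homo  = λ y y′ → rel (⊗-distribˡ x y y′)
        ; *-homo  = λ k y → rel (⊗-scaleʳ k x y)
        }
      }

    ⊗-lift : {P : Module R r s} {f : M.Carrierᴹ → N.Carrierᴹ → Module.Carrierᴹ P} →
             IsBilinearMap M N P f → IsLinearMap (M ⊗ N) P (extend P (uncurry f))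
    ⊗-lift {P = P} {f} F = extend-linear P resp
      where
      open IsBilinearMap F
      resp : ∀ {v w} → Bilinear M N v w → Module._≈ᴹ_ P (extend P (uncurry f) v) (extend P (uncurry f) w)
      resp (⊗-cong e e′)        = cong₂ e e′
      resp (⊗-distribʳ x x′ y)  = IsLinearMap.+-homo (linearˡ y) x x′
      resp (⊗-distribˡ x y y′)  = IsLinearMap.+-homo (linearʳ x) y y′
      resp (⊗-scaleˡ k x y)     = IsLinearMap.*-homo (linearˡ y) k x
      resp (⊗-scaleʳ k x y)     = IsLinearMap.*-homo (linearʳ x) k y

  bilinear-∘ : {L : Module R m n} {M : Module R p q} {N : Module R r s} {L′ : Module R a b} {M′ : Module R t u}
               {f : Module.Carrierᴹ L → Module.Carrierᴹ M → Module.Carrierᴹ N}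
               {g : Module.Carrierᴹ L′ → Module.Carrierᴹ L} {h : Module.Carrierᴹ M′ → Module.Carrierᴹ M} →
               IsBilinearMap L M N f → IsLinearMap L′ L g → IsLinearMap M′ M h →
               IsBilinearMap L′ M′ N (λ x y → f (g x) (h y))
  bilinear-∘ F G H = record
    { linearˡ = λ y → linear-∘ (IsBilinearMap.linearˡ F _) G
    ; linearʳ = λ x → linear-∘ (IsBilinearMap.linearʳ F _) H
    }

  module _ (M : Module R m n) where
    open Module M

    ∑-cong : {X : Set a} {f g : X → Carrierᴹ} (xs : List X) → (∀ {x} → x ∈ xs → f x ≈ᴹ g x) →
             ∑ M xs f ≈ᴹ ∑ M xs g
    ∑-cong []       f≈g = ≈ᴹ-refl
    ∑-cong (x ∷ xs) f≈g = +ᴹ-cong (f≈g (here refl)) (∑-cong xs (f≈g ∘ there))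

    ∑-↭ : {X : Set a} {f : X → Carrierᴹ} {xs ys : List X} → xs ↭ ys → ∑ M xs f ≈ᴹ ∑ M ys f
    ∑-↭ ↭.refl         = ≈ᴹ-refl
    ∑-↭ (↭.prep x e)   = +ᴹ-cong ≈ᴹ-refl (∑-↭ e)
    ∑-↭ (↭.swap x y e) = ≈ᴹ-trans (≈ᴹ-sym (+ᴹ-assoc _ _ _))
      (≈ᴹ-trans (+ᴹ-cong (+ᴹ-comm _ _) (∑-↭ e)) (+ᴹ-assoc _ _ _))
    ∑-↭ (↭.trans e e′) = ≈ᴹ-trans (∑-↭ e) (∑-↭ e′)

    ∑-map : {X : Set a} {Y : Set b} {f : Y → Carrierᴹ} (g : X → Y) (xs : List X) →
            ∑ M (List.map g xs) f ≡ ∑ M xs (f ∘ g)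
    ∑-map g []       = refl
    ∑-map g (x ∷ xs) = ≡.cong (_ +ᴹ_) (∑-map g xs)

    ∑-++ : {X : Set a} {f : X → Carrierᴹ} (xs ys : List X) →
           ∑ M (xs List.++ ys) f ≈ᴹ ∑ M xs f +ᴹ ∑ M ys f
    ∑-++ []       ys = ≈ᴹ-sym (+ᴹ-identityˡ _)
    ∑-++ (x ∷ xs) ys = ≈ᴹ-trans (+ᴹ-cong ≈ᴹ-refl (∑-++ xs ys)) (≈ᴹ-sym (+ᴹ-assoc _ _ _))

    ∑-concatMap : {X : Set a} {Y : Set b} {f : Y → Carrierᴹ} (g : X → List Y) (xs : List X) →
                  ∑ M (List.concatMap g xs) f ≈ᴹ ∑ M xs (λ x → ∑ M (g x) f)
    ∑-concatMap g []       = ≈ᴹ-refl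
    ∑-concatMap g (x ∷ xs) = ≈ᴹ-trans (∑-++ (g x) _) (+ᴹ-cong ≈ᴹ-refl (∑-concatMap g xs))

    ∑-cartesianProductWith : {X : Set a} {Y : Set b} {Z : Set d} {f : Z → Carrierᴹ} (g : X → Y → Z) →
      ∀ xs ys → ∑ M (cartesianProductWith g xs ys) f ≈ᴹ ∑ M xs (λ x → ∑ M ys (λ y → f (g x y)))
    ∑-cartesianProductWith g []       ys = ≈ᴹ-refl
    ∑-cartesianProductWith g (x ∷ xs) ys = ≈ᴹ-trans (∑-++ (List.map (g x) ys) _)
      (+ᴹ-cong (≈ᴹ-reflexive (∑-map (g x) ys)) (∑-cartesianProductWith g xs ys))

  linear-∑ : {M : Module R m n} {N : Module R p q} {h : Module.Carrierᴹ M → Module.Carrierᴹ N} →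
             IsLinearMap M N h → {X : Set a} {f : X → Module.Carrierᴹ M} →
             ∀ xs → Module._≈ᴹ_ N (h (∑ M xs f)) (∑ N xs (h ∘ f))
  linear-∑         H []       = IsLinearMap.0-homo H
  linear-∑ {N = N} H (x ∷ xs) = ≈ᴹ-trans (IsLinearMap.+-homo H _ _) (+ᴹ-cong ≈ᴹ-refl (linear-∑ H xs))
    where open Module N

  bilinear-∑ : {L : Module R m n} {M : Module R p q} {N : Module R r s}
               {h : Module.Carrierᴹ L → Module.Carrierᴹ M → Module.Carrierᴹ N} →
               IsBilinearMap L M N h →
               {X : Set a} {Y : Set b} {f : X → Module.Carrierᴹ L} {g : Y → Module.Carrierᴹ M} →
               ∀ xs ys → Module._≈ᴹ_ N (h (∑ L xs f) (∑ M ys g)) (∑ N xs λ x → ∑ N ys λ y → h (f x) (g y))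
  bilinear-∑ {N = N} H xs ys = Module.≈ᴹ-trans N (linear-∑ (linearˡ _) xs)
    (∑-cong N xs λ _ → linear-∑ (linearʳ _) ys)
    where open IsBilinearMap H

  free-homomorphism : (M : Module R m n) {S : Setoid a b} {f : Setoid.Carrier S → Module.Carrierᴹ M} →
    (∀ {x y} → Setoid._≈_ S x y → Module._≈ᴹ_ M (f x) (f y)) →
    ModuleMorphisms.IsModuleHomomorphism (Module.rawModule (Free S)) (Module.rawModule M) (extend M f)
  free-homomorphism M h = record { isBimoduleHomomorphism = record
    { +ᴹ-isGroupHomomorphism = record
      { isMonoidHomomorphism = record
        { isMagmaHomomorphism = record
          { isRelHomomorphism = record { cong = ⟦⟧-cong }
          ; homo              = +-homo
          }
        ; ε-homo = ≈ᴹ-refl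
        }
      -- Negation in `Free S` is by definition scaling by `- 1#`.
      ; ⁻¹-homo = λ x → ≈ᴹ-trans (*-homo (- 1#) x) -1*≈-
      }
    ; *ₗ-homo = *-homo
    ; *ᵣ-homo = λ k x → ≈ᴹ-trans (*-homo k x) (*ₗ-*ᵣ-coincident k _)
    } }
    where
    open Module M
    open IsLinearMap (free-linear M h)
    open GroupProperties +ᴹ-group using (inverseˡ-unique)
    -1*≈- : ∀ {x} → - 1# *ₗ x ≈ᴹ -ᴹ x
    -1*≈- {x} = inverseˡ-unique _ _ (≈ᴹ-trans (+ᴹ-cong ≈ᴹ-refl (≈ᴹ-sym (*ₗ-identityˡ x)))
      (≈ᴹ-trans (≈ᴹ-sym (*ₗ-distribʳ x (- 1#) 1#))
        (≈ᴹ-trans (*ₗ-cong (CommutativeRing.-‿inverseˡ R 1#) ≈ᴹ-refl) (*ₗ-zeroˡ x))))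

-- Product, triangularity of the coproduct, and antipodes of a natural Hopf algebra

module NaturalProperties (R : CommutativeRing c ℓ) (O : Operad o r)
                         (grading : Grading O) (factorizations : FinitelyFactorizable O) where
  open Linear R
  open LinearProperties R
  open Natural O grading factorizations
  open Operad O hiding (refl)
  open Grading grading
  private
    module W = Setoid reducedWordSetoid
    module N = Module N
    module N⊗N = Module (N ⊗ N)
    V = Combination ReducedWord

  ∙-bilinear : IsBilinearMap N N N _∙_
  ∙-bilinear = record
    { linearˡ = λ v → free-linear N λ e → extend-ext N (λ w → rel (gen-cong (ListPointwise.++⁺ e W.refl))) v
    ; linearʳ = extend-linearʳ λ w → free-linear N λ e → rel (gen-cong (ListPointwise.++⁺ (W.refl {w}) e))
    }

  ∙-identityʳ : ∀ v → v ∙ E [] N.≈ᴹ v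
  ∙-identityʳ (gen w) = N.≈ᴹ-reflexive (≡.cong E (List.++-identityʳ w))
  ∙-identityʳ 𝟘       = N.≈ᴹ-refl
  ∙-identityʳ (v ⊕ w) = ⊕-cong (∙-identityʳ v) (∙-identityʳ w)
  ∙-identityʳ (k ⊙ v) = ⊙-cong (CommutativeRing.refl R) (∙-identityʳ v)

  ∙⊗-bilinear : IsBilinearMap (N ⊗ N) (N ⊗ N) (N ⊗ N) _∙⊗_
  ∙⊗-bilinear = record
    { linearˡ = λ y → ⊗-lift record
      { linearˡ = λ v → extend-linearʳ (λ (u′ , v′) → linear-∘ (⊗.linearˡ _) (∙.linearˡ u′)) y
      ; linearʳ = λ u → extend-linearʳ (λ (u′ , v′) → linear-∘ (⊗.linearʳ _) (∙.linearˡ v′)) y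
      }
    ; linearʳ = extend-linearʳ λ (u , v) → ⊗-lift (bilinear-∘ ⊗-bilinear (∙.linearʳ u) (∙.linearʳ v))
    }
    where
    module ∙ = IsBilinearMap ∙-bilinear
    module ⊗ = IsBilinearMap (⊗-bilinear {M = N} {N = N})

  rd-∷ : ∀ y ys → rd (y ∷ ys) ≡ rd (y ∷ []) ++ rd ys
  rd-∷ y ys with y ≟𝟏
  ... | yes _ = refl
  ... | no  _ = refl

  rd-≉𝟏 : ∀ {y} ys → ¬ y ≈ 𝟏 → ∃[ y≉𝟏 ] rd (y ∷ ys) ≡ (y , y≉𝟏) ∷ rd ys
  rd-≉𝟏 {y} ys y≉𝟏 with y ≟𝟏
  ... | yes y≈𝟏 = ⊥-elim (y≉𝟏 y≈𝟏)
  ... | no  y≉𝟏 = y≉𝟏 , refl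

  rd-≈𝟏 : ∀ {y} ys → y ≈ 𝟏 → rd (y ∷ ys) ≡ rd ys
  rd-≈𝟏 {y} ys y≈𝟏 with y ≟𝟏
  ... | yes _   = refl
  ... | no  y≉𝟏 = ⊥-elim (y≉𝟏 y≈𝟏)

  wordDegree : ReducedWord → ℕ
  wordDegree []            = 0
  wordDegree ((y , _) ∷ w) = deg y + wordDegree w

  wordDegree-++ : ∀ w w′ → wordDegree (w ++ w′) ≡ wordDegree w + wordDegree w′
  wordDegree-++ []            w′ = refl
  wordDegree-++ ((y , _) ∷ w) w′ =
    ≡.trans (≡.cong (deg y +_) (wordDegree-++ w w′)) (≡.sym (ℕ.+-assoc (deg y) _ _))

  wordDegree-rd : ∀ y → wordDegree (rd (y ∷ [])) ≡ deg y
  wordDegree-rd y with y ≟𝟏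
  ... | yes y≈𝟏 = ≡.sym (≡.trans (deg-cong y≈𝟏) deg-𝟏)
  ... | no  _   = ℕ.+-identityʳ _

  -- Only left tensor factors are constrained, because the induction for antipodes exchanges the
  -- maps applied to the left factor and keeps the right one. Closure under scalars is absent: the
  -- coproduct of a word is a sum of pure tensors.
  data LeftSpan (P : Pred ReducedWord p) : Pred (Combination (V × V)) (c ⊔ o ⊔ r ⊔ p) where
    gen : ∀ {w v} → P w → LeftSpan P (gen (E w , v))
    𝟘   : LeftSpan P 𝟘
    _⊕_ : ∀ {x y} → LeftSpan P x → LeftSpan P y → LeftSpan P (x ⊕ y)

  leftSpan-map : {P : Pred ReducedWord p} {Q : Pred ReducedWord q} → (∀ {w} → P w → Q w) →
                 ∀ {x} → LeftSpan P x → LeftSpan Q x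
  leftSpan-map f (gen pw) = gen (f pw)
  leftSpan-map f 𝟘        = 𝟘
  leftSpan-map f (x ⊕ y)  = leftSpan-map f x ⊕ leftSpan-map f y

  -- Holds by computation: `E w ∙ E w′` reduces to `E (w ++ w′)`, and `_∙⊗_` unfolds along `𝟘` and
  -- `_⊕_` on the left, then on the right once the left factor is a generator.
  leftSpan-∙⊗ : {P : Pred ReducedWord p} {Q : Pred ReducedWord q} {T : Pred ReducedWord t} →
                (∀ {w w′} → P w → Q w′ → T (w ++ w′)) →
                ∀ {x y} → LeftSpan P x → LeftSpan Q y → LeftSpan T (x ∙⊗ y)
  leftSpan-∙⊗ f (gen pw) (gen qw) = gen (f pw qw)
  leftSpan-∙⊗ f (gen pw) 𝟘        = 𝟘
  leftSpan-∙⊗ f x@(gen _) (y ⊕ z) = leftSpan-∙⊗ f x y ⊕ leftSpan-∙⊗ f x z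
  leftSpan-∙⊗ f 𝟘        y        = 𝟘
  leftSpan-∙⊗ f (x ⊕ z)  y        = leftSpan-∙⊗ f x y ⊕ leftSpan-∙⊗ f z y

  private
    Below : ℕ → Pred (Combination (V × V)) (c ⊔ o ⊔ r)
    Below n = LeftSpan (λ w → wordDegree w < n)

    letterTensor : Factorization → Combination (V × V)
    letterTensor (z , zs) = gen (E (rd (z ∷ [])) , E (rd (Vec.toList zs)))

    module F = Setoid factorizationSetoid

  module _ (y : Carrier) (y≉𝟏 : ¬ y ≈ 𝟏) where
    private
      whole : Factorization
      whole = y , Vec.replicate ∣ y ∣ 𝟏

      -- A sum of degrees vanishes only if every summand does, and degree zero characterizes the
      -- unit. There are two lengths because the arities of equivalent elements are only provably
      -- equal.
      units : ∀ k {l} (zs : Vec Carrier l) → k ≡ l → Vec.sum (Vec.map deg zs) ≡ 0 →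
              Pointwise _≈_ (Vec.replicate k 𝟏) zs
      units zero    []       e    s = []
      units (suc k) (z ∷ zs) e    s = sym (deg≡0⇒𝟏 (ℕ.m+n≡0⇒m≡0 _ s)) ∷
        units k zs (ℕ.suc-injective e) (ℕ.m+n≡0⇒n≡0 (deg z) s)

      rd-units : ∀ k {l} {zs : Vec Carrier l} → Pointwise _≈_ (Vec.replicate k 𝟏) zs →
                 rd (Vec.toList zs) ≡ []
      rd-units zero    []       = refl
      rd-units (suc k) (e ∷ es) = ≡.trans (rd-≈𝟏 _ (sym e)) (rd-units k es)

      tensor-whole : ∀ {d} → whole F.≈ d → letterTensor d N⊗N.≈ᴹ gen (E ((y , y≉𝟏) ∷ []) , E [])
      tensor-whole {z , zs} (y≈z , es) with rd-≉𝟏 [] (λ z≈𝟏 → y≉𝟏 (trans y≈z z≈𝟏))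
      ... | _ , eq rewrite eq | rd-units ∣ y ∣ es = rel (⊗-cong (rel (gen-cong (sym y≈z ListPointwise.∷ ListPointwise.[]))) N.≈ᴹ-refl)

      -- If deg z = deg y in y = z[zs], then the letters of zs have total degree zero, so they are
      -- units and z ≈ y: the factorization is `whole`. Any other one has deg z < deg y.
      below : ∀ {d} → d factorizes y → ¬ whole F.≈ d → Below (deg y) (letterTensor d)
      below {z , zs} e whole≉d = gen (≡.subst₂ _<_ (≡.sym (wordDegree-rd z))
        (≡.trans (≡.sym (deg-⟦⟧ z zs)) (deg-cong e)) (go _ refl))
        where
        go : ∀ k → Vec.sum (Vec.map deg zs) ≡ k → deg z < deg z + k
        go (suc k) _ = ℕ.m<m+n (deg z) (s≤s z≤n)
        go zero    s = ⊥-elim (whole≉d (y≈z ,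
          units ∣ y ∣ zs (∣∣-cong y≈z) s))
          where
          y≈z : y ≈ z
          y≈z = sym (trans (sym (identityʳ z)) (trans (⟦⟧-cong (Setoid.refl setoid) (units ∣ z ∣ zs refl s)) e))

      all-below : ∀ {ds} → All (_factorizes y) ds → All (λ d → ¬ whole F.≈ d) ds →
                  Below (deg y) (∑ (N ⊗ N) ds letterTensor)
      all-below []       []       = 𝟘
      all-below {d ∷ _} (e ∷ es) (f ∷ fs) = below {d} e f ⊕ all-below es fs

      -- The trivial factorization may stand anywhere in the list. Its summand is carried to the
      -- front, and the absence of duplicates shows that it does not occur among the remaining ones.
      split : ∀ {ds} → All (_factorizes y) ds → AllPairs (λ d d′ → ¬ d F.≈ d′) ds → Any (whole F.≈_) ds →
              ∃[ x ] Below (deg y) x ×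
                ∑ (N ⊗ N) ds letterTensor N⊗N.≈ᴹ gen (E ((y , y≉𝟏) ∷ []) , E []) ⊕ x
      split {d ∷ ds} (_ ∷ es) (d≉ ∷ _) (here e) =
        _ , all-below es (All.map (λ {d′} d≉d′ e′ → d≉d′ (F.trans {d} {whole} {d′} (F.sym {whole} {d} e) e′)) d≉) ,
        ⊕-cong (tensor-whole e) N⊗N.≈ᴹ-refl
      split {d ∷ ds} (e ∷ es) (d≉ ∷ ds!) (there i) with split es ds! i
      ... | x , x-below , eq = letterTensor d ⊕ x ,
        below {d} e (λ w≈d → absurd d≉ i w≈d) ⊕ x-below ,
        transitive (⊕-cong reflexivity eq) (transitive (symmetry (⊕-assoc _ _ _))
          (transitive (⊕-cong (⊕-comm _ _) reflexivity) (⊕-assoc _ _ _)))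
        where
        absurd : ∀ {ds} → All (λ d′ → ¬ d F.≈ d′) ds → Any (whole F.≈_) ds → ¬ whole F.≈ d
        absurd {d′ ∷ _} (d≉ ∷ _) (here e)  w≈d = d≉ (F.trans {d} {whole} {d′} (F.sym {whole} {d} w≈d) e)
        absurd          (_ ∷ d≉) (there i) w≈d = absurd d≉ i w≈d

    Δ-letter-triangular : ∃[ x ] Below (deg y) x × Δ-letter y N⊗N.≈ᴹ gen (E ((y , y≉𝟏) ∷ []) , E []) ⊕ x
    Δ-letter-triangular = split sound unique (complete {whole} (identityʳ y))
      where open Enumeration (factorizations y)

  -- Expand (E_y ⊗ 1 + p)(E_w ⊗ 1 + q). The leading product is E_{yw} ⊗ 1. In (E_y ⊗ 1)q the degree
  -- drops in the part coming from w; in p(E_w ⊗ 1 + q) it drops in the part coming from y and does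
  -- not grow in the other.
  Δ-word-triangular : ∀ w → ∃[ x ] LeftSpan (λ w′ → wordDegree w′ < wordDegree w) x ×
                      Δ-word w N⊗N.≈ᴹ gen (E w , E []) ⊕ x
  Δ-word-triangular [] = 𝟘 , 𝟘 , N⊗N.≈ᴹ-sym (N⊗N.+ᴹ-identityʳ _)
  Δ-word-triangular ((y , y≉𝟏) ∷ w) with Δ-letter-triangular y y≉𝟏 | Δ-word-triangular w
  ... | p , p-below , p≈ | q , q-below , q≈ = _ ,
    (leftSpan-∙⊗ {P = λ w′ → w′ ≡ (y , y≉𝟏) ∷ []} (λ { refl w′< → ℕ.+-monoʳ-< (deg y) w′< }) (gen {v = E []} refl) q-below ⊕
     leftSpan-∙⊗ {Q = λ w′ → wordDegree w′ ≤ wordDegree w}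
       (λ {w₁} {w₂} w₁< w₂≤ → ≡.subst (_< _) (≡.sym (wordDegree-++ w₁ w₂)) (ℕ.+-mono-<-≤ w₁< w₂≤))
       p-below (gen {v = E []} ℕ.≤-refl ⊕ leftSpan-map ℕ.<⇒≤ q-below)) ,
    transitive (IsBilinearMap.cong₂ ∙⊗-bilinear p≈ q≈) (⊕-assoc _ _ _)

  -- Compatibility with antipodes from triangularity

  module _ (H : RawBialgebra m n) where
    private
      module A = RawBialgebra natural
      module H = RawBialgebra H
      H⊗H = H.space ⊗ H.space

    antipode-homo :
      IsBilinearMap H.space H.space H.space H._∙_ →
      (∀ v → v H.∙ H.𝟏ᴴ H.≈ᴹ v) →
      {φ : V → H.Carrierᴹ} →
      IsLinearMap N H.space φ →
      (∀ u v → φ (u ∙ v) H.≈ᴹ φ u H.∙ φ v) →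
      φ (E []) H.≈ᴹ H.𝟏ᴴ →
      (∀ u → Module._≈ᴹ_ H⊗H (H.Δ (φ u)) (extend H⊗H (λ (v , w) → gen (φ v , φ w)) (A.Δ u))) →
      (∀ u → CommutativeRing._≈_ R (H.ε (φ u)) (A.ε u)) →
      ∀ {S S′} → A.IsAntipode S → H.IsAntipode S′ →
      ∀ u → φ (S u) H.≈ᴹ S′ (φ u)
    antipode-homo H-bilinear H-identityʳ {φ} φ-linear φ-∙ φ-𝟏 φ-Δ φ-ε {S} {S′} S-antipode S′-antipode = φ-S
      where
      module S  = A.IsAntipode S-antipode
      module S′ = H.IsAntipode S′-antipode
      open IsBilinearMap H-bilinear using (cong₂)
      open SetoidReasoning H.≈ᴹ-setoid
      open GroupProperties H.+ᴹ-group using (∙-cancelʳ)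

      S-linear : IsLinearMap N N S
      S-linear = fromHomomorphism S.isLinear

      S′-linear : IsLinearMap H.space H.space S′
      S′-linear = fromHomomorphism S′.isLinear

      id-linear : IsLinearMap H.space H.space id
      id-linear = record { ⟦⟧-cong = id ; +-homo = λ _ _ → H.≈ᴹ-refl ; *-homo = λ _ _ → H.≈ᴹ-refl }

      f g : V → V → H.Carrierᴹ
      f v w = φ (S v) H.∙ φ w
      g v w = S′ (φ v) H.∙ φ w

      f-lift : IsLinearMap (N ⊗ N) H.space (extend H.space (uncurry f))
      f-lift = ⊗-lift (bilinear-∘ H-bilinear (linear-∘ φ-linear S-linear) φ-linear)

      g-lift : IsLinearMap (N ⊗ N) H.space (extend H.space (uncurry g))
      g-lift = ⊗-lift (bilinear-∘ H-bilinear (linear-∘ S′-linear φ-linear) φ-linear)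

      -- Multiplicativity of φ turns (φ ∘ S) * φ into φ ∘ (S * id), to which the left inverse law of
      -- `S` applies.
      f-Δ : ∀ u → extend H.space (uncurry f) (A.Δ u) H.≈ᴹ A.ε u H.*ₗ H.𝟏ᴴ
      f-Δ u = begin
        extend H.space (uncurry f) (A.Δ u)                     ≈⟨ extend-ext H.space (λ (v , w) → φ-∙ (S v) w) (A.Δ u) ⟨
        extend H.space (λ (v , w) → φ (S v ∙ w)) (A.Δ u)       ≈⟨ linear-extend φ-linear (A.Δ u) ⟨
        φ (A.convolve S id u)                                  ≈⟨ IsLinearMap.⟦⟧-cong φ-linear (S.inverseˡ u) ⟩
        φ (A.ε u ⊙ E [])                                       ≈⟨ IsLinearMap.*-homo φ-linear (A.ε u) (E []) ⟩
        A.ε u H.*ₗ φ (E [])                                    ≈⟨ H.*ₗ-cong (CommutativeRing.refl R) φ-𝟏 ⟩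
        A.ε u H.*ₗ H.𝟏ᴴ                                        ∎

      -- Compatibility of φ with Δ turns (S′ ∘ φ) * φ into (S′ * id) ∘ φ, to which the left inverse
      -- law of `S′` applies.
      g-Δ : ∀ u → extend H.space (uncurry g) (A.Δ u) H.≈ᴹ A.ε u H.*ₗ H.𝟏ᴴ
      g-Δ u = begin
        extend H.space (uncurry g) (A.Δ u)                     ≈⟨ linear-extend S′∙ (A.Δ u) ⟨
        extend H.space (λ (v , w) → S′ v H.∙ w) (extend H⊗H (λ (v , w) → gen (φ v , φ w)) (A.Δ u))
                                                               ≈⟨ IsLinearMap.⟦⟧-cong S′∙ (φ-Δ u) ⟨
        H.convolve S′ id (φ u)                                 ≈⟨ S′.inverseˡ (φ u) ⟩
        H.ε (φ u) H.*ₗ H.𝟏ᴴ                                    ≈⟨ H.*ₗ-cong (φ-ε u) H.≈ᴹ-refl ⟩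
        A.ε u H.*ₗ H.𝟏ᴴ                                        ∎
        where
        S′∙ : IsLinearMap H⊗H H.space (extend H.space (λ (v , w) → S′ v H.∙ w))
        S′∙ = ⊗-lift (bilinear-∘ H-bilinear S′-linear id-linear)

      ∙φ𝟏 : ∀ v → v H.∙ φ (E []) H.≈ᴹ v
      ∙φ𝟏 v = H.≈ᴹ-trans (cong₂ H.≈ᴹ-refl φ-𝟏) (H-identityʳ v)

      -- φ ∘ S and S′ ∘ φ are both left convolution inverses of φ, and the triangularity
      -- of Δ determines such an inverse recursively; no coassociativity is involved.
      S-word : ∀ x → Acc _<_ (wordDegree x) → φ (S (E x)) H.≈ᴹ S′ (φ (E x))
      S-word x (acc rec) = begin
        φ (S (E x))       ≈⟨ ∙φ𝟏 (φ (S (E x))) ⟨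
        f (E x) (E [])    ≈⟨ ∙-cancelʳ (extend H.space (uncurry f) y) (f (E x) (E [])) (g (E x) (E [])) leading ⟩
        g (E x) (E [])    ≈⟨ ∙φ𝟏 (S′ (φ (E x))) ⟩
        S′ (φ (E x))      ∎
        where
        triangular = Δ-word-triangular x
        y  = proj₁ triangular
        Δ≈ = proj₂ (proj₂ triangular)

        lower : ∀ {y} → LeftSpan (λ w → wordDegree w < wordDegree x) y →
                extend H.space (uncurry g) y H.≈ᴹ extend H.space (uncurry f) y
        lower (gen {w} w<) = cong₂ (H.≈ᴹ-sym (S-word w (rec w<))) H.≈ᴹ-refl
        lower 𝟘            = H.≈ᴹ-refl
        lower (p ⊕ q)      = H.+ᴹ-cong (lower p) (lower q)

        leading : f (E x) (E []) H.+ᴹ extend H.space (uncurry f) y H.≈ᴹ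
                  g (E x) (E []) H.+ᴹ extend H.space (uncurry f) y
        leading = begin
          f (E x) (E []) H.+ᴹ extend H.space (uncurry f) y  ≈⟨ IsLinearMap.⟦⟧-cong f-lift Δ≈ ⟨
          extend H.space (uncurry f) (Δ-word x)             ≈⟨ f-Δ (E x) ⟩
          ε-word x H.*ₗ H.𝟏ᴴ                                ≈⟨ g-Δ (E x) ⟨
          extend H.space (uncurry g) (Δ-word x)             ≈⟨ IsLinearMap.⟦⟧-cong g-lift Δ≈ ⟩
          g (E x) (E []) H.+ᴹ extend H.space (uncurry g) y  ≈⟨ H.+ᴹ-cong H.≈ᴹ-refl (lower (proj₁ (proj₂ triangular))) ⟩
          g (E x) (E []) H.+ᴹ extend H.space (uncurry f) y  ∎

      φ-S : ∀ u → φ (S u) H.≈ᴹ S′ (φ u)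
      φ-S = linear-unique (linear-∘ φ-linear S-linear) (linear-∘ S′-linear φ-linear)
        λ x → S-word x (<-wellFounded _)

-- Lifting words and factorizations along the projection

toList⁺ : {_~_ : Rel A r} {xs : Vec A k} {ys : Vec A l} →
          Pointwise _~_ xs ys → ListPointwise _~_ (Vec.toList xs) (Vec.toList ys)
toList⁺ []       = []
toList⁺ (e ∷ es) = e ∷ toList⁺ es

toList⁻ : {_~_ : Rel A r} {xs : Vec A k} {ys : Vec A l} →
          ListPointwise _~_ (Vec.toList xs) (Vec.toList ys) → Pointwise _~_ xs ys
toList⁻ {xs = []}    {[]}    []       = []
toList⁻ {xs = _ ∷ _} {_ ∷ _} (e ∷ es) = e ∷ toList⁻ es

-- Turns a list of lifts back into a vector that can be grafted. The length `k` will be the arity of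
-- a lifted term, which agrees with the arity `l` of the original one only through a proof.
fromPointwise : {_~_ : Rel A r} {xs : List A} (ys : Vec A l) → k ≡ l → ListPointwise _~_ xs (Vec.toList ys) →
                ∃[ zs ] Vec.toList {n = k} zs ≡ xs × Pointwise _~_ zs ys
fromPointwise []       refl []       = [] , refl , []
fromPointwise (y ∷ ys) refl (e ∷ es) with fromPointwise ys refl es
... | zs , refl , es′ = _ ∷ zs , refl , e ∷ es′

module Lifts (Sig : Signature a) (Γ : Congruence Sig r)
             (compatible : CompatibleWithDegree Γ) (finite : FiniteType Γ) where
  open Terms Sig hiding (Congruence; free; quotient)
  open Terms.Congruence Γ using (_≈_; isEquivalence; arity-cong)
  private
    module ≈ = IsEquivalence isEquivalence
    module Q = Operad (quotient Sig Γ)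
    module F = Setoid Q.factorizationSetoid
    module Class (t : Term) = Enumeration (finite t)

  infix 4 _≋_
  _≋_ : Rel (List Term) _
  _≋_ = ListPointwise _≈_

  ≋-sym : ∀ {ts us} → ts ≋ us → us ≋ ts
  ≋-sym = ListPointwise.symmetric ≈.sym

  ≋-trans : ∀ {ts us vs} → ts ≋ us → us ≋ vs → ts ≋ vs
  ≋-trans = ListPointwise.transitive ≈.trans

  class : Term → List Term
  class t = Class.elements t

  ∈-class⁺ : ∀ {t u} → u ≈ t → u ∈ class t
  ∈-class⁺ {t} = Class.complete t

  ∈-class⁻ : ∀ {t u} → u ∈ class t → u ≈ t
  ∈-class⁻ {t} = All.lookup (Class.sound t)

  -- Equivalent terms have equal degree, and the leaf is the only term of degree zero.
  ≈leaf⇒≡leaf : ∀ {t} → t ≈ leaf → t ≡ leaf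
  ≈leaf⇒≡leaf t≈leaf = degree≡0 (compatible t≈leaf)

  class-leaf : ∀ {t} → t ≈ leaf → class t ↭ leaf ∷ []
  class-leaf {t} t≈leaf = unique-↭ (Class.unique t) ([] ∷ [])
    (λ q → here (≈leaf⇒≡leaf (≈.trans (∈-class⁻ q) t≈leaf)))
    λ { (here refl) → ∈-class⁺ (≈.sym t≈leaf) }

  forests : List Term → List (List Term)
  forests []       = [] ∷ []
  forests (t ∷ ts) = cartesianProductWith _∷_ (class t) (forests ts)

  ∈-forests⁺ : ∀ {ts us} → us ≋ ts → us ∈ forests ts
  ∈-forests⁺ []       = here refl
  ∈-forests⁺ (e ∷ es) = ∈.∈-cartesianProductWith⁺ _∷_ (∈-class⁺ e) (∈-forests⁺ es)

  ∈-forests⁻ : ∀ ts {us} → us ∈ forests ts → us ≋ ts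
  ∈-forests⁻ []       (here refl) = []
  ∈-forests⁻ (t ∷ ts) q with ∈.∈-cartesianProductWith⁻ _∷_ (class t) (forests ts) q
  ... | _ , _ , q₁ , q₂ , refl = ∈-class⁻ q₁ ∷ ∈-forests⁻ ts q₂

  forests-unique : ∀ ts → Unique (forests ts)
  forests-unique []       = [] ∷ []
  forests-unique (t ∷ ts) = Unique.cartesianProductWith⁺ _∷_ List.∷-injective (Class.unique t) (forests-unique ts)

  forests-cong : ∀ {ts us} → ts ≋ us → forests ts ↭ forests us
  forests-cong {ts} {us} e = unique-↭ (forests-unique ts) (forests-unique us)
    (λ q → ∈-forests⁺ (≋-trans (∈-forests⁻ ts q) e)) (λ q → ∈-forests⁺ (≋-trans (∈-forests⁻ us q) (≋-sym e)))

  -- In a cut the length of the second component depends on the first. Forgetting this dependency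
  -- gives lifts of different factorizations a common type in which they are products of a class and
  -- a list of forests; nothing is lost, since the term determines the length.
  flatten : Cut → Term × List Term
  flatten (s , us) = s , Vec.toList us

  flatten-injective : ∀ {c d} → flatten c ≡ flatten d → c ≡ d
  flatten-injective {s , us} {_ , vs} e with List.∷-injective (≡.cong (λ (s , us) → s ∷ us) e)
  ... | refl , e′ = ≡.cong (s ,_) (≡.trans (≡.sym (Vec.cast-is-id refl us)) (Vec.toList-injective refl us vs e′))

  cutsOfClass : Term → List (Term × List Term)
  cutsOfClass y = List.map flatten (List.concatMap cuts (class y))

  liftsOfCut : Cut → List (Term × List Term)
  liftsOfCut (z , zs) = cartesianProductWith _,_ (class z) (forests (Vec.toList zs))

  ∈-liftsOfCut⁻ : ∀ {c s us} → (s , us) ∈ liftsOfCut c → s ≈ proj₁ c × us ≋ Vec.toList (proj₂ c)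
  ∈-liftsOfCut⁻ {z , zs} q with ∈.∈-cartesianProductWith⁻ _,_ (class z) (forests (Vec.toList zs)) q
  ... | _ , _ , q₁ , q₂ , refl = ∈-class⁻ q₁ , ∈-forests⁻ (Vec.toList zs) q₂

  module _ (y : Term) (factorizations : Enumeration Q.factorizationSetoid (Q._factorizes y)) where
    private
      module Fact = Enumeration factorizations

      liftsOfCuts : List (Term × List Term)
      liftsOfCuts = List.concatMap liftsOfCut Fact.elements

      cutsOfClass-unique : Unique (cutsOfClass y)
      cutsOfClass-unique = Unique.map⁺ flatten-injective
        (Unique.concat⁺ (All.map⁺ (All.universal cuts-unique _))
          (AllPairs.map⁺ {f = cuts} (AllPairs.map
            (λ {u} {v} u≢v {_} (q₁ , q₂) → u≢v (≡.trans (≡.sym (cuts-sound u q₁)) (cuts-sound v q₂)))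
            (Class.unique y))))

      liftsOfCuts-unique : Unique liftsOfCuts
      liftsOfCuts-unique = Unique.concat⁺
        (All.map⁺ (All.universal (λ (z , zs) → Unique.cartesianProductWith⁺ _,_ (λ { refl → refl , refl })
          (Class.unique z) (forests-unique (Vec.toList zs))) _))
        (AllPairs.map⁺ {f = liftsOfCut} (AllPairs.map disjoint Fact.unique))
        where
        disjoint : ∀ {c d} → ¬ c F.≈ d → ∀ {x} → ¬ (x ∈ liftsOfCut c × x ∈ liftsOfCut d)
        disjoint {c} {d} c≉d (q₁ , q₂) with ∈-liftsOfCut⁻ {c} q₁ | ∈-liftsOfCut⁻ {d} q₂
        ... | e , es | e′ , es′ = c≉d (≈.trans (≈.sym e) e′ , toList⁻ (≋-trans (≋-sym es) es′))

      ⊆ : ∀ {x} → x ∈ cutsOfClass y → x ∈ liftsOfCuts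
      ⊆ q with ∈.∈-map⁻ flatten q
      ... | (s , us) , q′ , refl with find (∈.∈-concatMap⁻ cuts {xs = class y} q′)
      -- The cut term `t` is `graft s us`, so membership of `t` in the class of `y` says that the
      -- cut is a factorization of `y` in the quotient.
      ...   | t , t∈ , q″ rewrite ≡.sym (cuts-sound t q″) = ∈.∈-concatMap⁺ liftsOfCut
        (Any.map (λ (e , es) → ∈.∈-cartesianProductWith⁺ _,_ (∈-class⁺ e) (∈-forests⁺ (toList⁺ es)))
          (Fact.complete {s , us} (∈-class⁻ t∈)))

      ⊇ : ∀ {x} → x ∈ liftsOfCuts → x ∈ cutsOfClass y
      ⊇ {s , us} q with find (∈.∈-concatMap⁻ liftsOfCut {xs = Fact.elements} q)
      ... | (z , zs) , c∈ , q′ with ∈-liftsOfCut⁻ {z , zs} q′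
      ...   | e , es with fromPointwise zs (arity-cong e) es
      ...     | vs , refl , es′ = ∈.∈-map⁺ flatten (∈.∈-concatMap⁺ cuts (Any.map
        (λ { refl → cuts-complete s vs })
        (∈-class⁺ (≈.trans (graft-cong Γ e es′) (All.lookup Fact.sound c∈)))))

    -- Both lists run through the pairs (s, us) with s[us] ≈ y, sorted on the left by the term s[us]
    -- and on the right by the factorization of y that the pair lifts. On the left there are no
    -- repetitions because grafting a cut returns the term that was cut; on the right because a
    -- common lift would make two factorizations equivalent.
    cuts↭lifts : cutsOfClass y ↭ List.concatMap liftsOfCut Fact.elements
    cuts↭lifts = unique-↭ cutsOfClass-unique liftsOfCuts-unique ⊆ ⊇

-- The fibres of the projection and the sums Φ

module Morphism (K : HeytingField c ℓ₁ ℓ₂) (Sig : Signature a) (Γ : Congruence Sig r)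
                (compatible : CompatibleWithDegree Γ) (finite : FiniteType Γ) where
  open Terms Sig hiding (Congruence; free; quotient)
  open Terms.Congruence Γ using (_≈_; isEquivalence)
  open Linear (ring K) hiding (IsHopfMorphism)
  open LinearProperties (ring K)
  open Theorem K Sig Γ compatible finite
  open Lifts Sig Γ compatible finite
  private
    module ≈   = IsEquivalence isEquivalence
    module R   = CommutativeRing (ring K)
    module P   = NaturalProperties (ring K) (free Sig) freeGrading freeFinitelyFactorizable
    module P≡  = NaturalProperties (ring K) (quotient Sig Γ) (quotientGrading Γ compatible)
                                   (quotientFinitelyFactorizable Γ finite)
    module H   = RawBialgebra N[T]
    module H≡  = RawBialgebra N[T/≡]
    module W   = Setoid NT.reducedWordSetoid
    module W≡  = Setoid NT≡.reducedWordSetoid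
    module N   = Module NT.N
    module N≡  = Module NT≡.N
    N⊗N        = NT.N ⊗ NT.N
    N≡⊗N≡      = NT≡.N ⊗ NT≡.N
    module N⊗N = Module N⊗N
    Kᴹ         = TensorUnit.⟨module⟩ {R = ring K}
    module ∙   = IsBilinearMap P.∙-bilinear
    module ∙⊗  = IsBilinearMap P.∙⊗-bilinear

  terms : NT.ReducedWord → List Term
  terms = List.map proj₁

  terms≡ : NT≡.ReducedWord → List Term
  terms≡ = List.map proj₁

  terms-cong : ∀ {f g} → f W.≈ g → terms f ≡ terms g
  terms-cong []       = refl
  terms-cong (e ∷ es) = ≡.cong₂ _∷_ e (terms-cong es)

  -- Equality of reduced words ignores the proofs that the letters differ from the leaf, so a
  -- reduced word is determined by its list of terms.
  terms-injective : ∀ f g → terms f ≡ terms g → f W.≈ g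
  terms-injective []      []      e = []
  terms-injective (_ ∷ f) (_ ∷ g) e with List.∷-injective e
  ... | e₁ , e₂ = e₁ ∷ terms-injective f g e₂

  terms-rd : ∀ {ts} → All (λ t → ¬ t ≡ leaf) ts → terms (NT.rd ts) ≡ ts
  terms-rd []                = refl
  terms-rd {t ∷ ts} (t≢ ∷ ps) with P.rd-≉𝟏 ts t≢
  ... | _ , eq rewrite eq = ≡.cong (t ∷_) (terms-rd ps)

  terms-reduced : ∀ f → All (λ t → ¬ t ≡ leaf) (terms f)
  terms-reduced []            = []
  terms-reduced ((_ , t≢) ∷ f) = t≢ ∷ terms-reduced f

  rd-terms : ∀ f → NT.rd (terms f) W.≈ f
  rd-terms f = terms-injective _ f (terms-rd (terms-reduced f))

  lift-reduced : ∀ x {ts} → ts ≋ terms≡ x → All (λ t → ¬ t ≡ leaf) ts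
  lift-reduced []             []       = []
  lift-reduced ((_ , y≉) ∷ x) (e ∷ es) = (λ { refl → y≉ (≈.sym e) }) ∷ lift-reduced x es

  forests-reduced : ∀ x {ts} → ts ∈ forests (terms≡ x) → terms (NT.rd ts) ≡ ts
  forests-reduced x q = terms-rd (lift-reduced x (∈-forests⁻ (terms≡ x) q))

  forests-rd : ∀ x {ts} → ts ∈ forests (terms≡ x) → terms (NT.rd ts) ≋ terms≡ x
  forests-rd x q = ≡.subst (_≋ _) (≡.sym (forests-reduced x q)) (∈-forests⁻ (terms≡ x) q)

  π≡⁺ : ∀ {f x} → terms f ≋ terms≡ x → f π≡ x
  π≡⁺ {f} = ≡.subst (_≋ _) (≡.sym (List.map-id (terms f)))

  π≡⁻ : ∀ {f x} → f π≡ x → terms f ≋ terms≡ x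
  π≡⁻ {f} = ≡.subst (_≋ _) (List.map-id (terms f))

  -- No letter of `x` is equivalent to the leaf, so every word in `forests (terms≡ x)` is reduced
  -- and `rd` serves only to attach the proofs of this.
  fibres : ∀ x → Fibre x
  fibres x = record
    { elements = List.map NT.rd ts
    ; sound    = All.map⁺ (All.tabulate λ {ts} q → π≡⁺ {NT.rd ts} {x} (forests-rd x q))
    ; complete = λ {f} e → Any.map (λ eq → W.trans (W.sym (rd-terms f)) (W.reflexive eq))
        (∈.∈-map⁺ NT.rd (∈-forests⁺ (π≡⁻ {f} {x} e)))
    -- `terms ∘ rd` fixes each listed forest, so the uniqueness of `forests` pulls back along
    -- `terms`.
    ; unique   = AllPairs.map (λ f≢g f≈g → f≢g (terms-cong f≈g)) (AllPairs.map⁻ (≡.subst Unique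
        (≡.sym (≡.trans (≡.sym (List.map-∘ ts)) (List.map-id-local (All.tabulate (forests-reduced x)))))
        (forests-unique (terms≡ x))))
    }
    where ts = forests (terms≡ x)

  Φ : List Term → N.Carrierᴹ
  Φ ts = ∑ NT.N (forests ts) (NT.E ∘ NT.rd)

  ∑-forests-++ : (M : Module (ring K) m n) {f : List Term → Module.Carrierᴹ M} → ∀ ts us →
                 Module._≈ᴹ_ M (∑ M (forests (ts ++ us)) f)
                               (∑ M (forests ts) λ ts′ → ∑ M (forests us) λ us′ → f (ts′ ++ us′))
  ∑-forests-++ M []       us = Module.≈ᴹ-sym M (Module.+ᴹ-identityʳ M _)
  ∑-forests-++ M {f} (t ∷ ts) us = begin
    ∑ M (forests (t ∷ ts ++ us)) f
      ≈⟨ ∑-cartesianProductWith M _∷_ (class t) _ ⟩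
    ∑ M (class t) (λ t′ → ∑ M (forests (ts ++ us)) (f ∘ (t′ ∷_)))
      ≈⟨ ∑-cong M (class t) (λ _ → ∑-forests-++ M ts us) ⟩
    ∑ M (class t) (λ t′ → ∑ M (forests ts) λ ts′ → ∑ M (forests us) λ us′ → f (t′ ∷ ts′ ++ us′))
      ≈⟨ ∑-cartesianProductWith M _∷_ (class t) _ ⟨
    ∑ M (forests (t ∷ ts)) (λ ts′ → ∑ M (forests us) λ us′ → f (ts′ ++ us′)) ∎
    where open SetoidReasoning (Module.≈ᴹ-setoid M)

  rd-++ : ∀ ts us → NT.rd (ts ++ us) ≡ NT.rd ts ++ NT.rd us
  rd-++ []       us = refl
  rd-++ (t ∷ ts) us = begin
    NT.rd (t ∷ ts ++ us)                              ≡⟨ P.rd-∷ t (ts ++ us) ⟩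
    NT.rd (t ∷ []) ++ NT.rd (ts ++ us)                ≡⟨ ≡.cong (NT.rd (t ∷ []) ++_) (rd-++ ts us) ⟩
    NT.rd (t ∷ []) ++ (NT.rd ts ++ NT.rd us)          ≡⟨ List.++-assoc (NT.rd (t ∷ [])) _ _ ⟨
    (NT.rd (t ∷ []) ++ NT.rd ts) ++ NT.rd us          ≡⟨ ≡.cong (_++ NT.rd us) (P.rd-∷ t ts) ⟨
    NT.rd (t ∷ ts) ++ NT.rd us                        ∎
    where open ≡.≡-Reasoning

  Φ-++ : ∀ ts us → Φ (ts ++ us) N.≈ᴹ Φ ts NT.∙ Φ us
  Φ-++ ts us = begin
    Φ (ts ++ us)
      ≈⟨ ∑-forests-++ NT.N ts us ⟩
    ∑ NT.N (forests ts) (λ ts′ → ∑ NT.N (forests us) λ us′ → NT.E (NT.rd (ts′ ++ us′)))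
      ≈⟨ ∑-cong NT.N (forests ts) (λ {ts′} _ → ∑-cong NT.N (forests us) λ {us′} _ →
           N.≈ᴹ-reflexive (≡.cong NT.E (rd-++ ts′ us′))) ⟩
    ∑ NT.N (forests ts) (λ ts′ → ∑ NT.N (forests us) λ us′ → NT.E (NT.rd ts′) NT.∙ NT.E (NT.rd us′))
      ≈⟨ bilinear-∑ P.∙-bilinear (forests ts) (forests us) ⟨
    Φ ts NT.∙ Φ us ∎
    where open SetoidReasoning N.≈ᴹ-setoid

  Φ-leaf : ∀ {t} ts → t ≈ leaf → Φ (t ∷ ts) N.≈ᴹ Φ ts
  Φ-leaf {t} ts t≈leaf = begin
    Φ (t ∷ ts)                 ≈⟨ ∑-cartesianProductWith NT.N _∷_ (class t) (forests ts) ⟩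
    ∑ NT.N (class t) Φ∷        ≈⟨ ∑-↭ NT.N (class-leaf t≈leaf) ⟩
    ∑ NT.N (leaf ∷ []) Φ∷      ≈⟨ N.+ᴹ-identityʳ (Φ ts) ⟩
    Φ ts                       ∎
    where
    open SetoidReasoning N.≈ᴹ-setoid
    Φ∷ : Term → N.Carrierᴹ
    Φ∷ t′ = ∑ NT.N (forests ts) λ ts′ → NT.E (NT.rd (t′ ∷ ts′))

  Φ-rd : ∀ ts → Φ (terms≡ (NT≡.rd ts)) N.≈ᴹ Φ ts
  Φ-rd []       = N.≈ᴹ-refl
  Φ-rd (t ∷ ts) = go (Grading._≟𝟏 (quotientGrading Γ compatible) t)
    where
    open SetoidReasoning N.≈ᴹ-setoid
    go : Dec (t ≈ leaf) → Φ (terms≡ (NT≡.rd (t ∷ ts))) N.≈ᴹ Φ (t ∷ ts)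
    go (yes t≈leaf) = begin
      Φ (terms≡ (NT≡.rd (t ∷ ts)))               ≡⟨ ≡.cong (Φ ∘ terms≡) (P≡.rd-≈𝟏 ts t≈leaf) ⟩
      Φ (terms≡ (NT≡.rd ts))                     ≈⟨ Φ-rd ts ⟩
      Φ ts                                       ≈⟨ Φ-leaf ts t≈leaf ⟨
      Φ (t ∷ ts)                                 ∎
    go (no t≉leaf) = begin
      Φ (terms≡ (NT≡.rd (t ∷ ts)))               ≡⟨ ≡.cong (Φ ∘ terms≡) (proj₂ (P≡.rd-≉𝟏 ts t≉leaf)) ⟩
      Φ (t ∷ terms≡ (NT≡.rd ts))                 ≈⟨ Φ-++ (t ∷ []) (terms≡ (NT≡.rd ts)) ⟩
      Φ (t ∷ []) NT.∙ Φ (terms≡ (NT≡.rd ts))     ≈⟨ IsLinearMap.⟦⟧-cong (∙.linearʳ (Φ (t ∷ []))) (Φ-rd ts) ⟩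
      Φ (t ∷ []) NT.∙ Φ ts                       ≈⟨ Φ-++ (t ∷ []) ts ⟨
      Φ (t ∷ ts)                                 ∎

  -- Compatibility of `φ` with the Hopf structure

  module _ (fibre : ∀ x → Fibre x) where
    private
      φ′ : N≡.Carrierᴹ → N.Carrierᴹ
      φ′ = φ fibre

      φ⊗φ : N≡.Carrierᴹ × N≡.Carrierᴹ → N⊗N.Carrierᴹ
      φ⊗φ (v , w) = gen (φ′ v , φ′ w)

    -- Frees the proof from the choice of `fibre`. Passing to `terms` makes the equality of reduced
    -- words propositional, and both lists of forests are then duplicate-free with the same members.
    φ-E : ∀ x → φ′ (NT≡.E x) N.≈ᴹ Φ (terms≡ x)
    φ-E x = begin
      ∑ NT.N elements NT.E                              ≈⟨ ∑-cong NT.N elements (λ {f} _ → rel (gen-cong (W.sym (rd-terms f)))) ⟩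
      ∑ NT.N elements (NT.E ∘ NT.rd ∘ terms)            ≡⟨ ∑-map NT.N terms elements ⟨
      ∑ NT.N (List.map terms elements) (NT.E ∘ NT.rd)   ≈⟨ ∑-↭ NT.N (unique-↭
        (AllPairs.map⁺ (AllPairs.map (λ {f} {g} f≉g e → f≉g (terms-injective f g e)) unique))
        (forests-unique (terms≡ x)) ⊆ ⊇) ⟩
      Φ (terms≡ x)                                      ∎
      where
      open Enumeration (fibre x)
      open SetoidReasoning N.≈ᴹ-setoid
      ⊆ : ∀ {ts} → ts ∈ List.map terms elements → ts ∈ forests (terms≡ x)
      ⊆ q with ∈.∈-map⁻ terms q
      ... | f , f∈ , refl = ∈-forests⁺ (π≡⁻ {f} {x} (All.lookup sound f∈))
      ⊇ : ∀ {ts} → ts ∈ forests (terms≡ x) → ts ∈ List.map terms elements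
      ⊇ {ts} q with find (complete {NT.rd ts} (π≡⁺ {NT.rd ts} {x} (forests-rd x q)))
      ... | f , f∈ , e = ≡.subst (_∈ _) (≡.trans (≡.sym (terms-cong e)) (forests-reduced x q)) (∈.∈-map⁺ terms f∈)

    φ-E-rd : ∀ ts → φ′ (NT≡.E (NT≡.rd ts)) N.≈ᴹ Φ ts
    φ-E-rd ts = N.≈ᴹ-trans (φ-E (NT≡.rd ts)) (Φ-rd ts)

    -- Well-definedness on the quotient: letterwise equivalent words have the same lifts.
    φ-E-cong : ∀ {x y} → x W≡.≈ y → φ′ (NT≡.E x) N.≈ᴹ φ′ (NT≡.E y)
    φ-E-cong {x} {y} e = N.≈ᴹ-trans (φ-E x) (N.≈ᴹ-trans
      (∑-↭ NT.N (forests-cong (ListPointwise.map⁺ proj₁ proj₁ e))) (N.≈ᴹ-sym (φ-E y)))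

    φ-linear : IsLinearMap NT≡.N NT.N φ′
    φ-linear = free-linear NT.N φ-E-cong

    φ-∙ : ∀ u v → φ′ (u NT≡.∙ v) N.≈ᴹ φ′ u NT.∙ φ′ v
    φ-∙ (gen x)  (gen y)  = begin
      φ′ (NT≡.E (x ++ y))            ≈⟨ φ-E (x ++ y) ⟩
      Φ (terms≡ (x ++ y))            ≡⟨ ≡.cong Φ (List.map-++ proj₁ x y) ⟩
      Φ (terms≡ x ++ terms≡ y)       ≈⟨ Φ-++ (terms≡ x) (terms≡ y) ⟩
      Φ (terms≡ x) NT.∙ Φ (terms≡ y) ≈⟨ ∙.cong₂ (φ-E x) (φ-E y) ⟨
      φ′ (NT≡.E x) NT.∙ φ′ (NT≡.E y) ∎
      where open SetoidReasoning N.≈ᴹ-setoid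
    φ-∙ (gen x) 𝟘       = N.≈ᴹ-sym (IsLinearMap.0-homo (∙.linearʳ (φ′ (NT≡.E x))))
    φ-∙ (gen x) (u ⊕ v) = N.≈ᴹ-trans (⊕-cong (φ-∙ (gen x) u) (φ-∙ (gen x) v))
      (N.≈ᴹ-sym (IsLinearMap.+-homo (∙.linearʳ (φ′ (NT≡.E x))) (φ′ u) (φ′ v)))
    φ-∙ (gen x) (k ⊙ v) = N.≈ᴹ-trans (⊙-cong R.refl (φ-∙ (gen x) v))
      (N.≈ᴹ-sym (IsLinearMap.*-homo (∙.linearʳ (φ′ (NT≡.E x))) k (φ′ v)))
    φ-∙ 𝟘       w = N.≈ᴹ-refl
    φ-∙ (u ⊕ v) w = ⊕-cong (φ-∙ u w) (φ-∙ v w)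
    φ-∙ (k ⊙ u) w = ⊙-cong R.refl (φ-∙ u w)

    φ-𝟏 : φ′ (NT≡.E []) N.≈ᴹ NT.E []
    φ-𝟏 = N.≈ᴹ-trans (φ-E []) (N.+ᴹ-identityʳ _)

    φ⊗φ-linear : IsLinearMap N≡⊗N≡ N⊗N (extend N⊗N φ⊗φ)
    φ⊗φ-linear = ⊗-lift (bilinear-∘ ⊗-bilinear φ-linear φ-linear)

    φ⊗φ-∙⊗ : ∀ p q → extend N⊗N φ⊗φ (p NT≡.∙⊗ q) N⊗N.≈ᴹ extend N⊗N φ⊗φ p NT.∙⊗ extend N⊗N φ⊗φ q
    φ⊗φ-∙⊗ (gen (u , v)) (gen (u′ , v′)) = rel (⊗-cong (φ-∙ u u′) (φ-∙ v v′))
    φ⊗φ-∙⊗ x@(gen _) 𝟘       = reflexivity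
    φ⊗φ-∙⊗ x@(gen _) (p ⊕ q) = ⊕-cong (φ⊗φ-∙⊗ x p) (φ⊗φ-∙⊗ x q)
    φ⊗φ-∙⊗ x@(gen _) (k ⊙ q) = ⊙-cong R.refl (φ⊗φ-∙⊗ x q)
    φ⊗φ-∙⊗ 𝟘       q = reflexivity
    φ⊗φ-∙⊗ (p ⊕ p′) q = ⊕-cong (φ⊗φ-∙⊗ p q) (φ⊗φ-∙⊗ p′ q)
    φ⊗φ-∙⊗ (k ⊙ p) q = ⊙-cong R.refl (φ⊗φ-∙⊗ p q)

    Δ-letter-homo : ∀ y → ∑ N⊗N (class y) NT.Δ-letter N⊗N.≈ᴹ extend N⊗N φ⊗φ (NT≡.Δ-letter y)
    Δ-letter-homo y = begin
      ∑ N⊗N (class y) NT.Δ-letter                                  ≈⟨ ∑-concatMap N⊗N cuts (class y) ⟨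
      ∑ N⊗N (List.concatMap cuts (class y)) (g ∘ flatten)          ≡⟨ ∑-map N⊗N flatten (List.concatMap cuts (class y)) ⟨
      -- The cuts, so far grouped by the member of the class that they cut, are regrouped by the
      -- factorization of `y` that they lift.
      ∑ N⊗N (cutsOfClass y) g                                      ≈⟨ ∑-↭ N⊗N (cuts↭lifts y fact) ⟩
      ∑ N⊗N (List.concatMap liftsOfCut elements) g                           ≈⟨ ∑-concatMap N⊗N liftsOfCut elements ⟩
      ∑ N⊗N elements (λ d → ∑ N⊗N (liftsOfCut d) g)              ≈⟨ ∑-cong N⊗N elements (λ {d} _ → lifts d) ⟩
      ∑ N⊗N elements (λ (z , zs) → φ⊗φ (NT≡.E (NT≡.rd (z ∷ [])) , NT≡.E (NT≡.rd (Vec.toList zs))))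
                                                                   ≈⟨ linear-∑ φ⊗φ-linear elements ⟨
      extend N⊗N φ⊗φ (NT≡.Δ-letter y)                              ∎
      where
      open SetoidReasoning N⊗N.≈ᴹ-setoid
      fact = quotientFinitelyFactorizable Γ finite y
      open Enumeration fact using (elements)

      g : Term × List Term → N⊗N.Carrierᴹ
      g (s , us) = gen (NT.E (NT.rd (s ∷ [])) , NT.E (NT.rd us))

      Φ-letter : ∀ z → Φ (z ∷ []) N.≈ᴹ ∑ NT.N (class z) (λ s → NT.E (NT.rd (s ∷ [])))
      Φ-letter z = N.≈ᴹ-trans (∑-cartesianProductWith NT.N _∷_ (class z) _)
        (∑-cong NT.N (class z) λ _ → N.+ᴹ-identityʳ _)

      lifts : ∀ ((z , zs) : Cut) → ∑ N⊗N (liftsOfCut (z , zs)) g N⊗N.≈ᴹ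
              φ⊗φ (NT≡.E (NT≡.rd (z ∷ [])) , NT≡.E (NT≡.rd (Vec.toList zs)))
      lifts (z , zs) = begin
        ∑ N⊗N (liftsOfCut (z , zs)) g
          ≈⟨ ∑-cartesianProductWith N⊗N _,_ (class z) (forests (Vec.toList zs)) ⟩
        ∑ N⊗N (class z) (λ s → ∑ N⊗N (forests (Vec.toList zs)) λ us → g (s , us))
          -- The lifts of one factorization form a product, so the double sum is a single pure
          -- tensor.
          ≈⟨ bilinear-∑ ⊗-bilinear (class z) (forests (Vec.toList zs)) ⟨
        gen (∑ NT.N (class z) (λ s → NT.E (NT.rd (s ∷ []))) , Φ (Vec.toList zs))
          ≈⟨ rel (⊗-cong (N.≈ᴹ-trans (φ-E-rd (z ∷ [])) (Φ-letter z)) (φ-E-rd (Vec.toList zs))) ⟨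
        φ⊗φ (NT≡.E (NT≡.rd (z ∷ [])) , NT≡.E (NT≡.rd (Vec.toList zs))) ∎

    Δ-linear : IsLinearMap NT.N N⊗N H.Δ
    Δ-linear = free-linear N⊗N Δ-cong
      where
      Δ-cong : ∀ {f g} → f W.≈ g → NT.Δ-word f N⊗N.≈ᴹ NT.Δ-word g
      Δ-cong []                        = reflexivity
      Δ-cong {(t , _) ∷ _} (refl ∷ es) = IsLinearMap.⟦⟧-cong (∙⊗.linearʳ (NT.Δ-letter t)) (Δ-cong es)

    Δ-Φ : ∀ x → ∑ N⊗N (forests (terms≡ x)) (NT.Δ-word ∘ NT.rd) N⊗N.≈ᴹ extend N⊗N φ⊗φ (NT≡.Δ-word x)
    Δ-Φ [] = transitive (N⊗N.+ᴹ-identityʳ _) (symmetry (rel (⊗-cong φ-𝟏 φ-𝟏)))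
    Δ-Φ ((y , y≉leaf) ∷ x) = begin
      ∑ N⊗N (forests (y ∷ terms≡ x)) (NT.Δ-word ∘ NT.rd)
        ≈⟨ ∑-cartesianProductWith N⊗N _∷_ (class y) (forests (terms≡ x)) ⟩
      ∑ N⊗N (class y) (λ t → ∑ N⊗N (forests (terms≡ x)) λ ts → NT.Δ-word (NT.rd (t ∷ ts)))
        -- The letter `y` is not equivalent to the leaf, so no `t` in its class is the leaf and `rd`
        -- keeps it as first letter.
        ≈⟨ ∑-cong N⊗N (class y) (λ t∈ → ∑-cong N⊗N (forests (terms≡ x)) λ {ts} _ → Δ-∷ t∈ ts) ⟩
      ∑ N⊗N (class y) (λ t → ∑ N⊗N (forests (terms≡ x)) λ ts → NT.Δ-letter t NT.∙⊗ NT.Δ-word (NT.rd ts))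
        ≈⟨ bilinear-∑ P.∙⊗-bilinear (class y) (forests (terms≡ x)) ⟨
      ∑ N⊗N (class y) NT.Δ-letter NT.∙⊗ ∑ N⊗N (forests (terms≡ x)) (NT.Δ-word ∘ NT.rd)
        ≈⟨ ∙⊗.cong₂ (Δ-letter-homo y) (Δ-Φ x) ⟩
      extend N⊗N φ⊗φ (NT≡.Δ-letter y) NT.∙⊗ extend N⊗N φ⊗φ (NT≡.Δ-word x)
        ≈⟨ φ⊗φ-∙⊗ (NT≡.Δ-letter y) (NT≡.Δ-word x) ⟨
      extend N⊗N φ⊗φ (NT≡.Δ-letter y NT≡.∙⊗ NT≡.Δ-word x) ∎
      where
      open SetoidReasoning N⊗N.≈ᴹ-setoid
      Δ-∷ : ∀ {t} → t ∈ class y → ∀ ts → NT.Δ-word (NT.rd (t ∷ ts)) N⊗N.≈ᴹ NT.Δ-letter t NT.∙⊗ NT.Δ-word (NT.rd ts)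
      Δ-∷ {t} t∈ ts = N⊗N.≈ᴹ-reflexive (≡.cong NT.Δ-word
        (proj₂ (P.rd-≉𝟏 {t} ts λ { refl → y≉leaf (≈.sym (∈-class⁻ t∈)) })))

    φ-Δ : ∀ u → H.Δ (φ′ u) N⊗N.≈ᴹ extend N⊗N φ⊗φ (H≡.Δ u)
    φ-Δ (gen x) = transitive (IsLinearMap.⟦⟧-cong Δ-linear (φ-E x))
      (transitive (linear-∑ Δ-linear (forests (terms≡ x))) (Δ-Φ x))
    φ-Δ 𝟘       = reflexivity
    φ-Δ (u ⊕ v) = ⊕-cong (φ-Δ u) (φ-Δ v)
    φ-Δ (k ⊙ u) = ⊙-cong R.refl (φ-Δ u)

    ε-linear : IsLinearMap NT.N Kᴹ H.ε
    ε-linear = free-linear Kᴹ ε-cong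
      where
      ε-cong : ∀ {f g} → f W.≈ g → NT.ε-word f R.≈ NT.ε-word g
      ε-cong []      = R.refl
      ε-cong (_ ∷ _) = R.refl

    φ-ε : ∀ u → H.ε (φ′ u) R.≈ H≡.ε u
    φ-ε (gen x) = R.trans (IsLinearMap.⟦⟧-cong ε-linear (φ-E x))
      (R.trans (linear-∑ ε-linear (forests (terms≡ x))) (ε-Φ x))
      where
      ε-Φ : ∀ x → ∑ Kᴹ (forests (terms≡ x)) (NT.ε-word ∘ NT.rd) R.≈ NT≡.ε-word x
      ε-Φ []       = R.+-identityʳ _
      -- A nonempty word has only nonempty lifts, and the counit vanishes on each of them.
      ε-Φ x@(_ ∷ _) = ∑-zero (forests (terms≡ x)) λ {ts} q → go (NT.rd ts) (forests-rd x q)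
        where
        go : ∀ f → terms f ≋ terms≡ x → NT.ε-word f R.≈ R.0#
        go (_ ∷ _) _ = R.refl
        ∑-zero : ∀ {A : Set a} {f : A → R.Carrier} xs → (∀ {z} → z ∈ xs → f z R.≈ R.0#) → ∑ Kᴹ xs f R.≈ R.0#
        ∑-zero []       h = R.refl
        ∑-zero (_ ∷ xs) h = R.trans (R.+-cong (h (here refl)) (∑-zero xs (h ∘ there))) (R.+-identityʳ _)
    φ-ε 𝟘       = R.refl
    φ-ε (u ⊕ v) = R.+-cong (φ-ε u) (φ-ε v)
    φ-ε (k ⊙ u) = R.*-cong R.refl (φ-ε u)

    φ-isHopfMorphism : IsHopfMorphism N[T/≡] N[T] φ′
    φ-isHopfMorphism = record
      { isLinear = free-homomorphism NT.N φ-E-cong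
      ; ∙-homo   = φ-∙
      ; 𝟏-homo   = φ-𝟏
      ; Δ-homo   = φ-Δ
      ; ε-homo   = φ-ε
      ; S-homo   = λ S-antipode S′-antipode → P≡.antipode-homo N[T] P.∙-bilinear P.∙-identityʳ
                     φ-linear φ-∙ φ-𝟏 φ-Δ φ-ε S-antipode S′-antipode
      }

    -- Injectivity: averaging over the fibres

    module _ (characteristicZero : CharacteristicZero K) where
      open Mult R.+-monoid using () renaming (_×_ to _·_)

      private
        reciprocal : ∀ n → ∃[ k ] (suc n · R.1#) R.* k R.≈ R.1#
        reciprocal n with HeytingField.#⇒invertible K (characteristicZero n)
        ... | k , _ , inv = k , R.trans (R.*-cong (R.sym x-0≈x) R.refl) inv
          where
          x-0≈x : ∀ {x} → x R.+ (R.- R.0#) R.≈ x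
          x-0≈x = R.trans (R.+-cong R.refl (GroupProperties.ε⁻¹≈ε R.+-group)) (R.+-identityʳ _)

        -- The value at zero is a placeholder: the lengths inverted below are those of nonempty
        -- lists, since every word is among its own lifts.
        inverse : ℕ → R.Carrier
        inverse zero    = R.0#
        inverse (suc n) = proj₁ (reciprocal n)

        ∑-const : ∀ {A : Set a} (xs : List A) v → ∑ NT≡.N xs (λ _ → v) N≡.≈ᴹ (List.length xs · R.1#) ⊙ v
        ∑-const []       v = symmetry (⊙-zeroˡ v)
        ∑-const (_ ∷ xs) v = transitive (⊕-cong (symmetry (⊙-identityˡ v)) (∑-const xs v))
          (symmetry (⊙-distribʳ v R.1# _))

        average : ∀ {A : Set a} {z : A} {xs} → z ∈ xs → ∀ v →
                  ∑ NT≡.N xs (λ _ → inverse (List.length xs) ⊙ v) N≡.≈ᴹ v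
        average {xs = xs@(_ ∷ xs′)} _ v = transitive (∑-const xs _) (transitive (symmetry (⊙-assoc _ _ v))
          (transitive (⊙-cong (proj₂ (reciprocal (List.length xs′))) reflexivity) (⊙-identityˡ v)))

        -- The projection on reduced words; it deletes no letter because only the leaf is equivalent
        -- to the leaf.
        project : NT.ReducedWord → NT≡.ReducedWord
        project = List.map λ (t , t≢leaf) → t , t≢leaf ∘ ≈leaf⇒≡leaf

        project-≈ : ∀ f x → terms f ≋ terms≡ x → project f W≡.≈ x
        project-≈ []      []      []       = []
        project-≈ (_ ∷ f) (_ ∷ x) (e ∷ es) = e ∷ project-≈ f x es

        weight : List Term → R.Carrier
        weight ts = inverse (List.length (forests ts))

        retract : NT.ReducedWord → N≡.Carrierᴹ
        retract f = weight (terms f) ⊙ NT≡.E (project f)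

        ψ : N.Carrierᴹ → N≡.Carrierᴹ
        ψ = extend NT≡.N retract

        ψ-linear : IsLinearMap NT.N NT≡.N ψ
        ψ-linear = free-linear NT≡.N λ {f} {g} e →
          ⊙-cong (R.reflexive (≡.cong weight (terms-cong e))) (rel (gen-cong (project-cong e)))
          where
          project-cong : ∀ {f g} → f W.≈ g → project f W≡.≈ project g
          project-cong []       = []
          project-cong (e ∷ es) = ≈.reflexive e ∷ project-cong es

        ψ-φ : ∀ u → ψ (φ′ u) N≡.≈ᴹ u
        ψ-φ (gen x) = begin
          ψ (φ′ (NT≡.E x))                                    ≈⟨ IsLinearMap.⟦⟧-cong ψ-linear (φ-E x) ⟩
          ψ (Φ (terms≡ x))                                    ≈⟨ linear-∑ ψ-linear ts ⟩
          ∑ NT≡.N ts (retract ∘ NT.rd)                        ≈⟨ ∑-cong NT≡.N ts retract-≈ ⟩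
          -- The word `terms≡ x` lies in its own list of forests, which rules out the empty list in
          -- `average`.
          ∑ NT≡.N ts (λ _ → weight (terms≡ x) ⊙ NT≡.E x)      ≈⟨ average {z = terms≡ x} {xs = ts} (∈-forests⁺ (ListPointwise.refl ≈.refl)) (NT≡.E x) ⟩
          NT≡.E x                                             ∎
          where
          open SetoidReasoning N≡.≈ᴹ-setoid
          ts = forests (terms≡ x)
          retract-≈ : ∀ {us} → us ∈ ts → retract (NT.rd us) N≡.≈ᴹ weight (terms≡ x) ⊙ NT≡.E x
          -- The weight is computed from a representative, but equivalent words have permuted lists
          -- of forests, so it is constant on the fibre and equals the one at `terms≡ x`.
          retract-≈ {us} q = ⊙-cong (R.reflexive (≡.cong inverse (↭-length (forests-cong (forests-rd x q)))))
            (rel (gen-cong (project-≈ (NT.rd us) x (forests-rd x q))))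
        ψ-φ 𝟘       = reflexivity
        ψ-φ (u ⊕ v) = ⊕-cong (ψ-φ u) (ψ-φ v)
        ψ-φ (k ⊙ u) = ⊙-cong R.refl (ψ-φ u)

      φ-injective : Injective N≡._≈ᴹ_ N._≈ᴹ_ φ′
      φ-injective {u} {v} e = N≡.≈ᴹ-trans (N≡.≈ᴹ-sym (ψ-φ u))
        (N≡.≈ᴹ-trans (IsLinearMap.⟦⟧-cong ψ-linear e) (ψ-φ v))

theorem3p5 : ∀ {c ℓ₁ ℓ₂ a r : Level}
    (K : HeytingField c ℓ₁ ℓ₂) → CharacteristicZero K →
    (Sig : Signature a) (Γ : Congruence Sig r)
    (compatible : CompatibleWithDegree Γ) (finite : FiniteType Γ) →
    let open Theorem K Sig Γ compatible finite in
    (∀ x → Fibre x) ×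
    (∀ (fibre : ∀ x → Fibre x) →
    IsHopfMorphism N[T/≡] N[T] (φ fibre) × Injective _≈ᴺᵀᐟ≡_ _≈ᴺᵀ_ (φ fibre))
theorem3p5 K characteristicZero Sig Γ compatible finite =
  fibres , λ fibre → φ-isHopfMorphism fibre , φ-injective fibre characteristicZero
  where open Morphism K Sig Γ compatible finite
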